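{- Let $\mathcal G$ be a constructor GRS over a finite signature $\mathcal F$ that is precedence terminating with argument separation (with precedence $\sqsubset$ and rank $\mathrm{rk}$ used in $\pi_\ell$), and let $d\in\mathbb N$ with $d\ge\max\big(\{\mathrm{ar}(f):f\in\mathcal F\}\cup\{|K{\restriction}r|:(K,l,r)\in\mathcal G_{\mathrm{fin}}\}\big)$. Suppose every rule $(K,l,r)\in\mathcal G_{\mathrm{inf}}$ satisfies: (i) $(K{\restriction}l)\cap\mathrm{nrm}$ is maximally shared; (ii) $K{\restriction}v$ is closed for every labeled node $v\in\mathrm{nrm}(l)$; (iii) $\big|\{v\in\mathrm{nrm}(l): v \text{ unlabeled}\}\cup\bigcup_{v\in\mathrm{safe}(l)}V_{K\restriction v}\big|\le d$; (iv) $|K{\restriction}r|\le|K{\restriction}l|+\big|\bigcup_{v\in\mathrm{nrm}(r)}V_{K\restriction v}\big|$. Then for every closed basic term graph $G_0\in\mathcal{TG}(\mathcal F)$ and all term graphs $G,H$ with $G_0\to^*_{\mathcal G}G\to_{\mathcal G}H$, and every integer $\ell$ with $2\big(\big|\bigcup_{v\in\mathrm{nrm}(\rho_{G_0})}V_{G_0\restriction v}\big|+d\big)\le\ell$, we have $\pi_\ell(H)<\pi_\ell(G)$.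
   Context: Term graphs. $\mathcal F=\mathcal C\cup\mathcal D$ is a finite signature (constructors and defined symbols, disjoint) with arity function $\mathrm{ar}$. A labeled graph consists of a finite acyclic directed graph $(V_G,E_G)$, a partial labeling $\mathrm{lab}_G:V_G\to\mathcal F$ and a successor function $\mathrm{att}_G:V_G\to V_G^*$ such that $\mathrm{att}_G(v)$ has length $\mathrm{ar}(\mathrm{lab}_G(v))$ if $v$ is labeled and is empty otherwise, and the set of entries of $\mathrm{att}_G(v)$ equals $\{u:(v,u)\in E_G\}$. Unlabeled nodes act as variables. A term graph additionally has a root $\rho_G$ from which every node is reachable; $\mathcal{TG}(\mathcal F)$ is the set of term graphs over $\mathcal F$, $\mathcal{TG}(\mathcal C)$ those whose labeled nodes carry constructors. $G{\restriction}v$ is the sub-term graph of nodes reachable from $v$, rooted at $v$; $H\subseteq G$ means $H=G{\restriction}v$ for some $v$. $|G|=|V_G|$; $\mathrm{depth}(G)$ is the length of a longest path from $\rho_G$. $G$ is closed if every node is labeled; basic if $\mathrm{lab}_G(\rho_G)\in\mathcal D$ and $G{\restriction}v\in\mathcal{TG}(\mathcal C)$ for every successor $v$ of $\rho_G$. Choosing an injective map from unlabeled nodes to variables, each $G{\restriction}v$ has a term representation $\mathrm{term}(G{\restriction}v)$; $G$ is maximally shared if $\mathrm{term}(G{\restriction}u)=\mathrm{term}(G{\restriction}v)$ implies $u=v$. Argument separation. The argument positions of each $f\in\mathcal F$ are split into normal and safe ones; constructors have only safe positions; nodes with the same label have the same separation. $\mathrm{nrm}(v)$ (resp. $\mathrm{safe}(v)$)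 is the set of successors of $v$ at normal (resp. safe) positions. $H\sqsubset_{\mathrm{nrm}}G$ means $H\subseteq G{\restriction}v$ for some $v\in\mathrm{nrm}(\rho_G)$. For a term graph $G$ with $\mathrm{att}_G(\rho_G)=v_1,\dots,v_k;v_{k+1},\dots,v_{k+l}$, $G\cap\mathrm{nrm}$ is the term graph with root $\rho_G$ whose nodes are $\rho_G$, the nodes of $G{\restriction}v$ for $v\in\mathrm{nrm}(\rho_G)$ (with their labels and successors from $G$), and $l$ fresh unlabeled nodes $u_1,\dots,u_l$, with $\mathrm{att}(\rho_G)=v_1,\dots,v_k;u_1,\dots,u_l$ (if no safe successor of the root is labeled, $G\cap\mathrm{nrm}=G$). Rewriting. Homomorphisms of labeled graphs preserve labels, successor sequences at labeled nodes (nothing required at unlabeled nodes) and the normal/safe split. A graph rewrite rule $(K,l,r)$ is a labeled graph $K$ with distinct nodes $l,r$ such that every unlabeled node of $K{\restriction}r$ lies in $K{\restriction}l$; it is a constructor rule if $K{\restriction}l$ is basic. A GRS is a (possibly infinite) set of rules; a constructor GRS consists of constructor rules. For a rule $(K,l,r)$ and homomorphism $\varphi:K{\restriction}l\to G$, the step $G\to_{\mathcal G}H$ is the standard build/redirection/garbage-collection step replacing $G{\restriction}\varphi(l)$ by an instance of $K{\restriction}r$ (new labeled nodes are fresh copies, unlabeled nodes are mapped via $\varphi$, edges into $\varphi(l)$ are redirected to the image of $r$, unreachable nodes removed). Since $\mathcal F$ is finite, $\mathcal D$ splits into $\mathcal D_{\mathrm{inf}}$ (symbols defined, i.e. labeling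 a left root, in infinitely many rules of $\mathcal G$) and $\mathcal D_{\mathrm{fin}}$ (the rest); $\mathcal G_{\mathrm{inf}}=\{(K,l,r)\in\mathcal G:\mathrm{lab}_K(l)\in\mathcal D_{\mathrm{inf}}\}$, $\mathcal G_{\mathrm{fin}}=\{(K,l,r)\in\mathcal G:\mathrm{lab}_K(l)\in\mathcal D_{\mathrm{fin}}\}$. Precedence termination with argument separation. A precedence $\sqsubset$ is a well-founded strict partial order on $\mathcal F$ with all constructors minimal, with a rank $\mathrm{rk}:\mathcal F\to\mathbb N$ such that $g\sqsubset f$ implies $\mathrm{rk}(g)<\mathrm{rk}(f)$. $H\sqsubset_{\mathrm{pt}}G$ holds if $\mathrm{lab}_H(v)\sqsubset\mathrm{lab}_G(\rho_G)$ for every labeled node $v$ of $H$ and either (1) $H=G{\restriction}u$ or $H\sqsubset_{\mathrm{pt}}G{\restriction}u$ for some successor $u$ of $\rho_G$; or (2) $\rho_H$ is labeled, $H{\restriction}v\sqsubset_{\mathrm{nrm}}G$ for each $v\in\mathrm{nrm}(\rho_H)$, and $H{\restriction}v\sqsubset_{\mathrm{pt}}G$ for each $v\in\mathrm{safe}(\rho_H)$. $\mathcal G$ is precedence terminating with argument separation if for some separation and precedence, $K{\restriction}r\sqsubset_{\mathrm{pt}}K{\restriction}l$ for every rule. Safe paths, $\mathcal{TG}_{\mathrm{nrm}}$ and interpretation. A path is safe if each next node is a safe successor of the previous; $\mathrm{SP}_G$ is the set of nodes on a safe path from $\rho_G$ (including $\rho_G$). $G\in\mathcal{TG}_{\mathrm{nrm}}(\mathcal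 F)$ iff $G\in\mathcal{TG}(\mathcal C)$, or $G{\restriction}v\in\mathcal{TG}(\mathcal C)$ for all $v\in\mathrm{nrm}(\rho_G)$ and $G{\restriction}v\in\mathcal{TG}_{\mathrm{nrm}}(\mathcal F)$ for all $v\in\mathrm{safe}(\rho_G)$. For positive $\ell$ and closed $G$ with labeled root, $\mathrm{pj}_\ell(G)=(1+\ell)^{2\,\mathrm{rk}(\mathrm{lab}_G(\rho_G))}\big(1+\sum_{u\in\mathrm{nrm}(\rho_G)}\mathrm{depth}(G{\restriction}u)\big)$, and for closed $G\in\mathcal{TG}_{\mathrm{nrm}}(\mathcal F)$, $\pi_\ell(G)=\sum\{\mathrm{pj}_\ell(G{\restriction}v):v\in\mathrm{SP}_G,\ G{\restriction}v\notin\mathcal{TG}(\mathcal C)\}$. -}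

module Defs where

open import Level using (0ℓ)
open import Data.Nat.Base using (ℕ; zero; suc; _+_; _*_; _^_; _≤_; _<_; z≤n; s≤s)
import Data.Nat.Properties as ℕ
open import Data.Nat.ListAction using (sum)
open import Data.Fin.Base using (Fin; zero; suc; _↑ˡ_; _↑ʳ_)
open import Data.Fin.Properties using (_≟_; any?; all?)
open import Data.Fin.Induction using (spo-noetherian)
open import Data.Fin.Subset using (Subset; _∈_; _∉_)
open import Data.Fin.Subset.Properties using (_∈?_)
open import Data.Vec.Base as Vec using (Vec; lookup; tabulate; replicate; _[_]≔_)
open import Data.List.Base as List using (List; length; filter; allFin)
import Data.List.Membership.Propositional as ListMembership
open import Data.Maybe.Base using (Maybe; just; nothing; maybe)
open import Data.Maybe.Properties using (≡-dec)
open import Data.Product.Base using (Σ; ∃; _×_; _,_; proj₁; proj₂)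
open import Data.Sum.Base using (_⊎_; inj₁; inj₂)
open import Data.Empty using (⊥)
open import Data.Unit.Base using (⊤; tt)
open import Data.Bool.Base using (if_then_else_)
open import Function.Base using (_∘_; flip)
open import Induction.WellFounded using (Acc; acc; WellFounded)
open import Relation.Nullary.Negation.Core using (¬_; contradiction)
open import Relation.Nullary.Decidable using (Dec; yes; no; does; map′; ¬?; _×-dec_; _⊎-dec_; _→-dec_)
open import Relation.Unary using (Pred; Decidable)
open import Relation.Binary.Core using (Rel)
import Relation.Binary.Definitions as B
open import Relation.Binary.Structures using (IsStrictPartialOrder)
open import Relation.Binary.PropositionalEquality.Core using (_≡_; _≢_; refl; resp₂)
open import Relation.Binary.PropositionalEquality.Properties using (isEquivalence)
open import Relation.Binary.Construct.Closure.ReflexiveTransitive using (Star; ε; _◅_)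
open import Relation.Binary.Construct.Closure.Transitive using (TransClosure; [_]; _∷_; _++_)

card : ∀ {n} {P : Pred (Fin n) 0ℓ} → Decidable P → ℕ
card P? = length (filter P? (allFin _))

sumOver : ∀ {n} {P : Pred (Fin n) 0ℓ} → Decidable P → (Fin n → ℕ) → ℕ
sumOver P? f = sum (List.map f (filter P? (allFin _)))

data Path {A : Set} (R : Rel A 0ℓ) : A → ℕ → Set where
  stop : ∀ {v} → Path R v 0
  step : ∀ {v w k} → R v w → Path R w k → Path R v (suc k)

IsLargest : Pred ℕ 0ℓ → Pred ℕ 0ℓ
IsLargest P k = P k × (∀ j → P j → j ≤ k)

acyclic⇒noetherian : ∀ {n} {R : Rel (Fin n) 0ℓ} →
  (∀ v → ¬ TransClosure R v v) → WellFounded (flip R)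
acyclic⇒noetherian {R = R} acyclic v = weaken (spo-noetherian isSPO v)
  where
  isSPO : IsStrictPartialOrder _≡_ (TransClosure R)
  isSPO = record
    { isEquivalence = isEquivalence
    ; irrefl        = λ { refl p → acyclic _ p }
    ; trans         = _++_
    ; <-resp-≈      = resp₂ (TransClosure R)
    }

  weaken : ∀ {v} → Acc (flip (TransClosure R)) v → Acc (flip R) v
  weaken (acc rs) = acc λ r → weaken (rs [ r ])

module _ {n : ℕ} {R : Rel (Fin n) 0ℓ} (R? : B.Decidable R) where

  star?-acc : ∀ v → Acc (flip R) v → ∀ u → Dec (Star R v u)
  star?-acc v (acc rs) u with v ≟ u
  ... | yes refl = yes ε
  ... | no v≢u = map′ to from (any? via?)
    where
    via? : ∀ w → Dec (R v w × Star R w u)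
    via? w with R? v w
    ... | no ¬r = no (¬r ∘ proj₁)
    ... | yes r = map′ (r ,_) proj₂ (star?-acc w (rs r) u)

    to : ∃ (λ w → R v w × Star R w u) → Star R v u
    to (w , r , p) = r ◅ p

    from : Star R v u → ∃ (λ w → R v w × Star R w u)
    from ε       = contradiction refl v≢u
    from (r ◅ p) = _ , r , p

  star? : WellFounded (flip R) → B.Decidable (Star R)
  star? wf v = star?-acc v (wf v)

  largest-⋃ : ∀ {m} (P : Fin m → Pred ℕ 0ℓ) →
    (∀ i → ∃ (IsLargest (P i)) ⊎ (∀ k → ¬ P i k)) →
    ∃ (IsLargest (λ k → ∃ λ i → P i k)) ⊎ (∀ k → ¬ ∃ λ i → P i k)
  largest-⋃ {zero} P h = inj₂ λ { k (() , _) }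
  largest-⋃ {suc m} P h with h zero | largest-⋃ (P ∘ suc) (h ∘ suc)
  ... | inj₂ ¬p | inj₂ ¬q = inj₂ λ { k (zero , p) → ¬p k p ; k (suc i , p) → ¬q k (i , p) }
  ... | inj₂ ¬p | inj₁ (b , (i , q) , ub) =
    inj₁ (b , (suc i , q) , λ { j (zero , p) → contradiction p (¬p j) ; j (suc i′ , p) → ub j (i′ , p) })
  ... | inj₁ (a , p , ub) | inj₂ ¬q =
    inj₁ (a , (zero , p) , λ { j (zero , p′) → ub j p′ ; j (suc i , q) → contradiction (i , q) (¬q j) })
  ... | inj₁ (a , p , ubp) | inj₁ (b , (i , q) , ubq) with ℕ.≤-total a b
  ...   | inj₁ a≤b = inj₁ (b , (suc i , q) ,
            λ { j (zero , p′) → ℕ.≤-trans (ubp j p′) a≤b ; j (suc i′ , q′) → ubq j (i′ , q′) })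
  ...   | inj₂ b≤a = inj₁ (a , (zero , p) ,
            λ { j (zero , p′) → ubp j p′ ; j (suc i′ , q′) → ℕ.≤-trans (ubq j (i′ , q′)) b≤a })

  longest-acc : ∀ v → Acc (flip R) v → ∃ (IsLargest (Path R v))
  longest-acc v (acc rs) with largest-⋃ (λ w k → R v w × Path R w k) via
    where
    via : ∀ w → ∃ (IsLargest (λ k → R v w × Path R w k)) ⊎ (∀ k → ¬ (R v w × Path R w k))
    via w with R? v w
    ... | no ¬r = inj₂ λ k → ¬r ∘ proj₁
    ... | yes r with longest-acc w (rs r)
    ...   | k , p , ub = inj₁ (k , (r , p) , λ j → ub j ∘ proj₂)
  ... | inj₁ (k , (w , r , p) , ub) =
    suc k , step r p , λ { _ stop → z≤n ; _ (step r′ p′) → s≤s (ub _ (_ , r′ , p′)) }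
  ... | inj₂ ¬p =
    0 , stop , λ { _ stop → z≤n ; _ (step r′ p′) → contradiction (_ , r′ , p′) (¬p _) }

  longestPath : WellFounded (flip R) → ∀ v → ∃ (IsLargest (Path R v))
  longestPath wf v = longest-acc v (wf v)

record Signature : Set where
  field
    size         : ℕ
    constructors : Subset size
    ar           : Fin size → ℕ

  Sym : Set
  Sym = Fin size

record Separation (F : Signature) : Set where
  open Signature F
  -- The argument positions of f outside nrm f are the safe ones.
  field
    nrm              : (f : Sym) → Subset (ar f)
    constructor-safe : ∀ {c} → c ∈ constructors → ∀ i → i ∉ nrm c

record Precedence (F : Signature) : Set₁ where
  open Signature F
  field
    _⊏_                  : Rel Sym 0ℓ
    isStrictPartialOrder : IsStrictPartialOrder _≡_ _⊏_
    wellFounded          : WellFounded _⊏_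
    constructor-minimal  : ∀ {c} → c ∈ constructors → ∀ f → ¬ (f ⊏ c)
    rk                   : Sym → ℕ
    rk-mono              : ∀ {g f} → g ⊏ f → rk g < rk f

-- Content of a node: its label together with its successor sequence, if any.
data NodeData (F : Signature) (n : ℕ) : Set where
  unlabeled : NodeData F n
  labeled   : (f : Signature.Sym F) → Vec (Fin n) (Signature.ar F f) → NodeData F n

module _ {F : Signature} where
  open Signature F

  mapData : ∀ {m n} → (Fin m → Fin n) → NodeData F m → NodeData F n
  mapData θ unlabeled      = unlabeled
  mapData θ (labeled f vs) = labeled f (Vec.map θ vs)

  label : ∀ {n} → NodeData F n → Maybe Sym
  label unlabeled     = nothing
  label (labeled f _) = just f

  -- u is a successor at a position satisfying P.
  OccursAt : ∀ {n} → ((f : Sym) → Pred (Fin (ar f)) 0ℓ) → NodeData F n → Fin n → Set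
  OccursAt P unlabeled      u = ⊥
  OccursAt P (labeled f vs) u = ∃ λ i → P f i × lookup vs i ≡ u

  occursAt? : ∀ {n} {P : (f : Sym) → Pred (Fin (ar f)) 0ℓ} → (∀ f → Decidable (P f)) →
    (x : NodeData F n) → Decidable (OccursAt P x)
  occursAt? P? unlabeled      u = no λ ()
  occursAt? P? (labeled f vs) u = any? λ i → P? f i ×-dec lookup vs i ≟ u

-- Labeled graphs without the acyclicity requirement.  Node names are an
-- initial segment of ℕ; the edges are determined by the successor sequences.
record PreGraph (F : Signature) : Set where
  open Signature F
  field
    order : ℕ
    nodes : Vec (NodeData F order) order

  Node : Set
  Node = Fin order

  str : Node → NodeData F order
  str = lookup nodes

  lab : Node → Maybe Sym
  lab v = label (str v)

  Labeled Unlabeled : Pred Node 0ℓ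
  Labeled   v = ∃ λ f → lab v ≡ just f
  Unlabeled v = lab v ≡ nothing

  infix 4 _⟶_ _⟶*_ _⟶⁺_
  _⟶_ _⟶*_ _⟶⁺_ : Rel Node 0ℓ
  v ⟶ u = OccursAt (λ _ _ → ⊤) (str v) u
  _⟶*_ = Star _⟶_
  _⟶⁺_ = TransClosure _⟶_

  lab≟ : ∀ v x → Dec (lab v ≡ x)
  lab≟ v x = ≡-dec _≟_ (lab v) x

  unlabeled? : Decidable Unlabeled
  unlabeled? v = lab≟ v nothing

  labeled? : Decidable Labeled
  labeled? v = any? λ f → lab≟ v (just f)

  _⟶?_ : B.Decidable _⟶_
  v ⟶? u = occursAt? (λ _ _ → yes tt) (str v) u

record LabeledGraph (F : Signature) : Set where
  field
    preGraph : PreGraph F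
  open PreGraph preGraph public
  field
    acyclic : ∀ v → ¬ (v ⟶⁺ v)

  noetherian : WellFounded (flip _⟶_)
  noetherian = acyclic⇒noetherian acyclic

  _⟶*?_ : B.Decidable _⟶*_
  _⟶*?_ = star? _⟶?_ noetherian

record TermGraph (F : Signature) : Set where
  field
    labeledGraph : LabeledGraph F
  open LabeledGraph labeledGraph public
  field
    root      : Node
    reachable : ∀ v → root ⟶* v

-- The sub-term graph G↾v is represented by G together with the node v; its
-- nodes are the u with v ⟶* u.  In particular a term graph G is G↾root.
module _ {F : Signature} (G : LabeledGraph F) where
  open Signature F
  open LabeledGraph G

  size↾ : Node → ℕ
  size↾ v = card (v ⟶*?_)

  depth↾ : Node → ℕ
  depth↾ v = proj₁ (longestPath _⟶?_ noetherian v)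

  Closed : Pred Node 0ℓ
  Closed v = ∀ u → v ⟶* u → Labeled u

  -- G↾v ∈ TG(C)
  IsConstructorGraph : Pred Node 0ℓ
  IsConstructorGraph v = ∀ u → v ⟶* u → ∀ f → lab u ≡ just f → f ∈ constructors

  isConstructorGraph? : Decidable IsConstructorGraph
  isConstructorGraph? v =
    all? λ u → (v ⟶*? u) →-dec all? λ f → lab≟ u (just f) →-dec f ∈? constructors

  Basic : Pred Node 0ℓ
  Basic v = (∃ λ f → lab v ≡ just f × f ∉ constructors) × (∀ u → v ⟶ u → IsConstructorGraph u)

data Term (F : Signature) (X : Set) : Set where
  var : X → Term F X
  app : (f : Signature.Sym F) → Vec (Term F X) (Signature.ar F f) → Term F X

module _ {F : Signature} (G : PreGraph F) where
  open PreGraph G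

  -- v ⇓ t states that term(G↾v) = t, where each unlabeled node serves as its
  -- own variable.  On an acyclic graph ⇓ is the graph of a total function.
  infix 4 _⇓_
  data _⇓_ : Node → Term F Node → Set where
    var : ∀ {v} → str v ≡ unlabeled → v ⇓ var v
    app : ∀ {v f vs ts} → str v ≡ labeled f vs →
          (∀ i → lookup vs i ⇓ lookup ts i) → v ⇓ app f ts

  MaximallyShared : Pred Node 0ℓ
  MaximallyShared ρ = ∀ u v t → ρ ⟶* u → ρ ⟶* v → u ⇓ t → v ⇓ t → u ≡ v

module _ {F : Signature} (sep : Separation F) where
  open Signature F
  open Separation sep

  module _ (G : PreGraph F) where
    open PreGraph G

    NrmSucc SafeSucc : Rel Node 0ℓ
    NrmSucc  v u = OccursAt (λ f i → i ∈ nrm f) (str v) u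
    SafeSucc v u = OccursAt (λ f i → i ∉ nrm f) (str v) u

    nrmSucc? : B.Decidable NrmSucc
    nrmSucc? v = occursAt? (λ f i → i ∈? nrm f) (str v)

    safeSucc? : B.Decidable SafeSucc
    safeSucc? v = occursAt? (λ f i → ¬? (i ∈? nrm f)) (str v)

    -- G with the i-th successor of ρ, for each safe position i, replaced by
    -- the fresh unlabeled node order ↑ʳ i.  Nodes that are not reachable from
    -- ρ any more (among them the fresh nodes of normal positions) do not
    -- belong to the term graph rooted at ρ.
    cutSafe : (ρ : Node) (f : Sym) → Vec Node (ar f) → PreGraph F
    cutSafe ρ f vs = record
      { order = order + ar f
      ; nodes = (Vec.map (mapData (_↑ˡ ar f)) nodes [ ρ ]≔ labeled f args)
                Vec.++ replicate (ar f) unlabeled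
      }
      where
      args : Vec (Fin (order + ar f)) (ar f)
      args = tabulate λ i → if does (i ∈? nrm f) then lookup vs i ↑ˡ ar f else order ↑ʳ i

    -- (G↾ρ) ∩ nrm, as a graph with a root
    ∩nrm : Node → Σ (PreGraph F) PreGraph.Node
    ∩nrm ρ with any? (λ u → safeSucc? ρ u ×-dec labeled? u) | str ρ
    ... | yes _ | labeled f vs = cutSafe ρ f vs , ρ ↑ˡ ar f
    ... | yes _ | unlabeled    = G , ρ
    ... | no _  | _            = G , ρ

  module _ (G : LabeledGraph F) where
    open LabeledGraph G

    -- u ∈ ⋃_{w ∈ nrm(v)} V_{G↾w}, and likewise for safe
    NrmPart SafePart : Rel Node 0ℓ
    NrmPart  v u = ∃ λ w → NrmSucc  preGraph v w × w ⟶* u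
    SafePart v u = ∃ λ w → SafeSucc preGraph v w × w ⟶* u

    nrmPart? : B.Decidable NrmPart
    nrmPart? v u = any? λ w → nrmSucc? preGraph v w ×-dec w ⟶*? u

    safePart? : B.Decidable SafePart
    safePart? v u = any? λ w → safeSucc? preGraph v w ×-dec w ⟶*? u

    SafePath : Rel Node 0ℓ
    SafePath = Star (SafeSucc preGraph)

    safeSucc⇒⟶ : ∀ {v u} → SafeSucc preGraph v u → v ⟶ u
    safeSucc⇒⟶ {v} p with str v
    safeSucc⇒⟶ (i , _ , e) | labeled _ _ = i , tt , e

    safePath? : B.Decidable SafePath
    safePath? = star? (safeSucc? preGraph) (λ v → weaken (noetherian v))
      where
      weaken : ∀ {v} → Acc (flip _⟶_) v → Acc (flip (SafeSucc preGraph)) v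
      weaken (acc rs) = acc λ s → weaken (rs (safeSucc⇒⟶ s))

    -- G↾v ∈ TG_nrm(F)
    data InTGnrm (v : Node) : Set where
      constructorGraph : IsConstructorGraph G v → InTGnrm v
      nrm-safe : (∀ u → NrmSucc preGraph v u → IsConstructorGraph G u) →
                 (∀ u → SafeSucc preGraph v u → InTGnrm u) → InTGnrm v

module _ {F : Signature} (sep : Separation F) (prec : Precedence F) (K : LabeledGraph F) where
  open LabeledGraph K
  open Precedence prec

  -- In the relations below h and g stand for the term graphs K↾h and K↾g.

  infix 4 _⊏nrm_ _⊏pt_
  _⊏nrm_ : Rel Node 0ℓ
  h ⊏nrm g = ∃ λ w → NrmSucc sep preGraph g w × w ⟶* h

  LabelsBelow : Rel Node 0ℓ
  LabelsBelow h g = ∀ v f → h ⟶* v → lab v ≡ just f → ∃ λ f′ → lab g ≡ just f′ × f ⊏ f′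

  data _⊏pt_ (h g : Node) : Set where
    sub-≡  : LabelsBelow h g → g ⟶ h → h ⊏pt g
    sub-⊏  : ∀ {u} → LabelsBelow h g → g ⟶ u → h ⊏pt u → h ⊏pt g
    decomp : LabelsBelow h g → Labeled h →
             (∀ v → NrmSucc sep preGraph h v → v ⊏nrm g) →
             (∀ v → SafeSucc sep preGraph h v → v ⊏pt g) → h ⊏pt g

record Triple (F : Signature) : Set where
  field
    K   : LabeledGraph F
    l r : LabeledGraph.Node K

  lhsLab : Maybe (Signature.Sym F)
  lhsLab = LabeledGraph.lab K l

record IsRule {F : Signature} (ρ : Triple F) : Set where
  open Triple ρ
  open LabeledGraph K
  field
    l≢r       : l ≢ r
    variables : ∀ u → r ⟶* u → Unlabeled u → l ⟶* u

record GRS (F : Signature) : Set₁ where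
  field
    Rule   : Pred (Triple F) 0ℓ
    isRule : ∀ {ρ} → Rule ρ → IsRule ρ

module _ {F : Signature} (𝒢 : GRS F) where
  open Signature F
  open GRS 𝒢

  IsConstructorGRS : Set
  IsConstructorGRS = ∀ ρ → Rule ρ → Basic (Triple.K ρ) (Triple.l ρ)

  FinitelyDefined : Pred Sym 0ℓ
  FinitelyDefined f = ∃ λ (ρs : List (Triple F)) →
    ∀ ρ → Rule ρ → Triple.lhsLab ρ ≡ just f → ρ ListMembership.∈ ρs

  𝒟fin 𝒟inf : Pred Sym 0ℓ
  𝒟fin f = f ∉ constructors × FinitelyDefined f
  𝒟inf f = f ∉ constructors × ¬ FinitelyDefined f

  𝒢fin 𝒢inf : Pred (Triple F) 0ℓ
  𝒢fin ρ = Rule ρ × ∃ λ f → Triple.lhsLab ρ ≡ just f × 𝒟fin f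
  𝒢inf ρ = Rule ρ × ∃ λ f → Triple.lhsLab ρ ≡ just f × 𝒟inf f

  IsPrecedenceTerminating : Separation F → Precedence F → Set
  IsPrecedenceTerminating sep prec =
    ∀ ρ → Rule ρ → let open Triple ρ in _⊏pt_ sep prec K r l

-- Homomorphisms K↾l → G.  The values of φ outside K↾l are irrelevant.  The
-- normal/safe split is preserved since it is determined by the labels.
IsHom : {F : Signature} (K G : LabeledGraph F) → LabeledGraph.Node K →
        (LabeledGraph.Node K → LabeledGraph.Node G) → Set
IsHom K G l φ = ∀ v → K._⟶*_ l v → K.Labeled v → G.str (φ v) ≡ mapData φ (K.str v)
  where
  module K = LabeledGraph K
  module G = LabeledGraph G

module _ {F : Signature} (ρ : Triple F) (G : TermGraph F)
         (φ : LabeledGraph.Node (Triple.K ρ) → TermGraph.Node G) where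
  open Triple ρ
  private
    module K = LabeledGraph K
    module G = TermGraph G

  -- Build phase: the nodes of K are added to those of G, and the nodes of
  -- K↾l are then represented by their images under φ.
  built : K.Node → Fin (G.order + K.order)
  built u = if does (l K.⟶*? u) then φ u ↑ˡ K.order else G.order ↑ʳ u

  redirect : Fin (G.order + K.order) → Fin (G.order + K.order)
  redirect x = if does (x ≟ φ l ↑ˡ K.order) then built r else x

  contractum : PreGraph F
  contractum = record
    { order = G.order + K.order
    ; nodes = Vec.map (mapData (redirect ∘ (_↑ˡ K.order))) G.nodes
              Vec.++ Vec.map (mapData (redirect ∘ built)) K.nodes
    }

  contractumRoot : PreGraph.Node contractum
  contractumRoot = redirect (G.root ↑ˡ K.order)

-- H is isomorphic to P↾p.  All nodes of H being reachable from its root, the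
-- image of such an embedding is exactly the set of nodes of P reachable from
-- p, so this expresses garbage collection.
record _≅_↾_ {F : Signature} (H : TermGraph F) (P : PreGraph F) (p : PreGraph.Node P) : Set where
  private
    module H = TermGraph H
    module P = PreGraph P
  field
    θ         : H.Node → P.Node
    injective : ∀ {u v} → θ u ≡ θ v → u ≡ v
    root      : θ H.root ≡ p
    str       : ∀ v → P.str (θ v) ≡ mapData θ (H.str v)

record Step {F : Signature} (𝒢 : GRS F) (G H : TermGraph F) : Set where
  field
    ρ      : Triple F
    rule   : GRS.Rule 𝒢 ρ
    φ      : LabeledGraph.Node (Triple.K ρ) → TermGraph.Node G
    isHom  : IsHom (Triple.K ρ) (TermGraph.labeledGraph G) (Triple.l ρ) φ
    result : H ≅ contractum ρ G φ ↾ contractumRoot ρ G φ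

Steps : {F : Signature} → GRS F → Rel (TermGraph F) 0ℓ
Steps 𝒢 = Star (Step 𝒢)

module _ {F : Signature} (sep : Separation F) (d : ℕ) (ρ : Triple F) where
  open Triple ρ
  open LabeledGraph K

  record InfRuleConditions : Set where
    field
      shared : let P , p = ∩nrm sep preGraph l in MaximallyShared P p
      closed : ∀ v → NrmSucc sep preGraph l v → Labeled v → Closed K v
      small  : card (λ u → (nrmSucc? sep preGraph l u ×-dec unlabeled? u)
                           ⊎-dec safePart? sep K l u) ≤ d
      growth : size↾ K r ≤ size↾ K l + card (nrmPart? sep K r)

record InDomain-π {F : Signature} (sep : Separation F) (G : TermGraph F) : Set where
  open TermGraph G
  field
    closed  : Closed labeledGraph root
    inTGnrm : InTGnrm sep labeledGraph root

module _ {F : Signature} (sep : Separation F) (prec : Precedence F) where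
  open Signature F
  open Precedence prec

  -- The value 0 at an unlabeled node is never used in π.
  pj : ℕ → (G : LabeledGraph F) → LabeledGraph.Node G → ℕ
  pj ℓ G v = maybe (λ f → (1 + ℓ) ^ (2 * rk f)) 0 (LabeledGraph.lab G v)
             * (1 + sumOver (nrmSucc? sep (LabeledGraph.preGraph G) v) (depth↾ G))

  π : ℕ → (G : TermGraph F) → InDomain-π sep G → ℕ
  π ℓ G _ = sumOver (λ v → safePath? sep labeledGraph root v
                           ×-dec ¬? (isConstructorGraph? labeledGraph v))
                    (pj ℓ labeledGraph)
    where open TermGraph G

{-# OPTIONS --safe #-}

-- Every term graph reachable from a closed basic G₀ is closed, has only constructor graphs at
-- normal positions, and has normal parts of at most N nodes, where N is the size of the normal part
-- of G₀: by clause (2) of ⊏pt a rewrite step never builds anything new below a normal position.  A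
-- step at φ(l) removes the summand of φ(l) from π and adds summands of fresh copies of nodes of
-- K↾r, whose labels have smaller rank and whose normal arguments all lie below normal arguments of
-- φ(l).  Each new summand is thus at most (1 + ℓ)^(2(rk - 1)) (1 + d D), with D the sum of the
-- depths of the normal arguments of φ(l), and there are at most |K↾r| ≤ 1 + 2(N + d) ≤ 1 + ℓ of
-- them.  For the rules of 𝒢inf the last bound comes from (iv), since φ is injective on the labeled
-- nodes of the normal part of l: these root closed graphs, so nodes with the same image have the
-- same term and are identified by maximal sharing.
module Submission where

open import Defs
open import Level using (0ℓ)
open import Data.Nat.Base using (ℕ; suc; _+_; _*_; _^_; _≤_; _<_; z≤n; s≤s)
import Data.Nat.Properties as ℕ
open import Data.Nat.ListAction using (sum)
open import Data.Nat.ListAction.Properties using (sum-++; sum-↭)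
open import Data.Nat.Tactic.RingSolver using (solve-∀)
open import Data.Fin.Base using (Fin; _↑ˡ_; _↑ʳ_; splitAt)
open import Data.Fin.Properties using (_≟_; any?; ↑ˡ-injective; splitAt-↑ˡ; splitAt-↑ʳ)
open import Data.Fin.Subset using (_∈_; _∉_)
open import Data.Fin.Subset.Properties using (_∈?_)
open import Data.Vec.Base as Vec using (Vec; lookup; tabulate; replicate; _[_]≔_)
import Data.Vec.Properties as Vec
open import Data.List.Base using (List; []; _∷_; _++_; [_]; length; map; filter; allFin)
open import Data.List.Properties using (length-++; length-tabulate; map-∘; map-++)
open import Data.List.Membership.Propositional using () renaming (_∈_ to _∈ᴸ_)
open import Data.List.Membership.Propositional.Properties
open import Data.List.Relation.Unary.Any using (here; there)
import Data.List.Relation.Unary.All as All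
import Data.List.Relation.Unary.All.Properties as All
open import Data.List.Relation.Unary.Unique.Propositional using (Unique; []; _∷_)
import Data.List.Relation.Unary.Unique.Propositional.Properties as Unique
open import Data.List.Relation.Binary.Permutation.Propositional using (↭-sym)
open import Data.List.Relation.Binary.Permutation.Propositional.Properties using (shift; ∈-resp-↭; map⁺)
open import Data.Maybe.Base using (Maybe; just; nothing; maybe)
open import Data.Maybe.Properties using (just-injective)
open import Data.Product.Base using (∃; _×_; _,_; proj₁; proj₂; Σ-syntax)
open import Data.Sum.Base using (_⊎_; inj₁; inj₂)
open import Data.Empty using (⊥)
open import Data.Unit.Base using (⊤; tt)
open import Data.Bool.Base using (if_then_else_)
open import Function.Base using (_∘_; id; flip)
open import Induction.WellFounded using (Acc; acc)
open import Relation.Nullary.Negation.Core using (¬_; contradiction)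
open import Relation.Nullary.Decidable using (Dec; yes; no; ¬?; _×-dec_; _⊎-dec_; does; dec-true; dec-false; decidable-stable)
open import Relation.Unary using (Pred; Decidable)
open import Relation.Binary.Structures using (IsStrictPartialOrder)
open import Relation.Binary.PropositionalEquality using (_≡_; _≢_; refl; sym; trans; cong; cong₂; subst; subst₂; module ≡-Reasoning)
open import Relation.Binary.Construct.Closure.ReflexiveTransitive using (ε; _◅_; _◅◅_)
import Relation.Binary.Construct.Closure.Transitive as Plus

-- Sums over matched lists

module _ {A B : Set} (R : A → B → Set) (f : A → ℕ) (g : B → ℕ)
         (R-injective : ∀ {x x′ y} → R x y → R x′ y → x ≡ x′) where

  -- The partner of the head of `xs` is deleted from `ys`. Injectivity of `R` and uniqueness of `xs`
  -- show that no later element is matched to it, so `ys` may contain repetitions.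
  sum-matching : ∀ {xs} ys → Unique xs →
    (∀ {x} → x ∈ᴸ xs → ∃ λ y → y ∈ᴸ ys × R x y × f x ≤ g y) →
    sum (map f xs) ≤ sum (map g ys)
  sum-matching ys [] match = z≤n
  sum-matching ys (_∷_ {x} {xs} x∉xs unique) match with match (here refl)
  ... | y , y∈ys , Rxy , fx≤gy with ∈-∃++ y∈ys
  ... | ys₁ , ys₂ , refl = begin
    f x + sum (map f xs)              ≤⟨ ℕ.+-mono-≤ fx≤gy (sum-matching (ys₁ ++ ys₂) unique match′) ⟩
    g y + sum (map g (ys₁ ++ ys₂))    ≡⟨ sum-↭ (map⁺ g (↭-sym (shift y ys₁ ys₂))) ⟩
    sum (map g (ys₁ ++ y ∷ ys₂))      ∎
    where
    open ℕ.≤-Reasoning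
    match′ : ∀ {x′} → x′ ∈ᴸ xs → ∃ λ y′ → y′ ∈ᴸ (ys₁ ++ ys₂) × R x′ y′ × f x′ ≤ g y′
    match′ x′∈xs with match (there x′∈xs)
    ... | y′ , y′∈ys , Rx′y′ , le with ∈-resp-↭ (shift y ys₁ ys₂) y′∈ys
    ... | here refl = contradiction (R-injective Rxy Rx′y′) (All.lookup x∉xs x′∈xs)
    ... | there y′∈ = y′ , y′∈ , Rx′y′ , le

length≡sum : ∀ {A : Set} (xs : List A) → length xs ≡ sum (map (λ _ → 1) xs)
length≡sum []       = refl
length≡sum (x ∷ xs) = cong suc (length≡sum xs)

length-matching : ∀ {A B : Set} (R : A → B → Set) →
  (∀ {x x′ y} → R x y → R x′ y → x ≡ x′) → ∀ {xs} ys → Unique xs →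
  (∀ {x} → x ∈ᴸ xs → ∃ λ y → y ∈ᴸ ys × R x y) → length xs ≤ length ys
length-matching R R-injective {xs} ys unique match =
  subst₂ _≤_ (sym (length≡sum xs)) (sym (length≡sum ys))
    (sum-matching R _ _ R-injective ys unique
      λ x∈ → let y , y∈ , Rxy = match x∈ in y , y∈ , Rxy , ℕ.≤-refl)

-- The factor `c` replaces a division of `b`: the weights of fresh nodes are estimated after
-- multiplication by a power of 1 + ℓ, which avoids subtraction in exponents.
sum-map-*-≤ : ∀ {A : Set} (f : A → ℕ) c b (xs : List A) →
  (∀ {x} → x ∈ᴸ xs → f x * c ≤ b) → sum (map f xs) * c ≤ length xs * b
sum-map-*-≤ f c b []       f≤ = z≤n
sum-map-*-≤ f c b (x ∷ xs) f≤ = begin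
  (f x + sum (map f xs)) * c      ≡⟨ ℕ.*-distribʳ-+ c (f x) _ ⟩
  f x * c + sum (map f xs) * c    ≤⟨ ℕ.+-mono-≤ (f≤ (here refl)) (sum-map-*-≤ f c b xs (f≤ ∘ there)) ⟩
  b + length xs * b               ∎
  where open ℕ.≤-Reasoning

module _ {n} {P : Pred (Fin n) 0ℓ} (P? : Decidable P) where

  elements : List (Fin n)
  elements = filter P? (allFin n)

  ∈-elements⁺ : ∀ {x} → P x → x ∈ᴸ elements
  ∈-elements⁺ {x} Px = ∈-filter⁺ P? (∈-allFin x) Px

  ∈-elements⁻ : ∀ {x} → x ∈ᴸ elements → P x
  ∈-elements⁻ x∈ = proj₂ (∈-filter⁻ P? {xs = allFin n} x∈)

  elements-unique : Unique elements
  elements-unique = Unique.filter⁺ P? (Unique.allFin⁺ n)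

  ≤-sumOver : ∀ (f : Fin n → ℕ) {x} → P x → f x ≤ sumOver P? f
  ≤-sumOver f {x} Px = subst (_≤ sumOver P? f) (ℕ.+-identityʳ (f x))
    (sum-matching _≡_ f f (λ { refl refl → refl }) {xs = [ x ]} elements (All.[] ∷ [])
      λ { (here refl) → x , ∈-elements⁺ Px , refl , ℕ.≤-refl })

module _ {m n} {P : Pred (Fin m) 0ℓ} {Q : Pred (Fin n) 0ℓ} (P? : Decidable P) (Q? : Decidable Q)
         (R : Fin m → Fin n → Set) (R-injective : ∀ {x x′ y} → R x y → R x′ y → x ≡ x′) where

  sumOver-matching : ∀ f g → (∀ {x} → P x → ∃ λ y → Q y × R x y × f x ≤ g y) →
    sumOver P? f ≤ sumOver Q? g
  sumOver-matching f g match = sum-matching R f g R-injective _ (elements-unique P?)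
    λ x∈ → let y , Qy , Rxy , le = match (∈-elements⁻ P? x∈) in y , ∈-elements⁺ Q? Qy , Rxy , le

  card-matching : (∀ {x} → P x → ∃ λ y → Q y × R x y) → card P? ≤ card Q?
  card-matching match = length-matching R R-injective _ (elements-unique P?)
    λ x∈ → let y , Qy , Rxy = match (∈-elements⁻ P? x∈) in y , ∈-elements⁺ Q? Qy , Rxy

card-empty : ∀ {n} {P : Pred (Fin n) 0ℓ} (P? : Decidable P) → (∀ x → ¬ P x) → card P? ≡ 0
card-empty P? ¬P = ℕ.n≤0⇒n≡0 (length-matching _≡_ (λ { refl refl → refl }) [] (elements-unique P?)
  λ {x} x∈ → contradiction (∈-elements⁻ P? x∈) (¬P x))

-- Successors and depth

module _ {F : Signature} where
  open Signature F

  label-mapData : ∀ {m n} (α : Fin m → Fin n) (x : NodeData F m) → label (mapData α x) ≡ label x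
  label-mapData α unlabeled      = refl
  label-mapData α (labeled f vs) = refl

  label-transfer : ∀ {m m′ n} {α : Fin m → Fin n} {β : Fin m′ → Fin n}
    (x : NodeData F m) (y : NodeData F m′) → mapData α x ≡ mapData β y → label x ≡ label y
  label-transfer {α = α} {β} x y eq =
    trans (sym (label-mapData α x)) (trans (cong label eq) (label-mapData β y))

  module _ {P : (f : Sym) → Pred (Fin (ar f)) 0ℓ} where

    occursAt-map⁺ : ∀ {m n} (α : Fin m → Fin n) (x : NodeData F m) {u} →
      OccursAt P x u → OccursAt P (mapData α x) (α u)
    occursAt-map⁺ α (labeled f vs) (i , p , refl) = i , p , Vec.lookup-map i α vs

    occursAt-map⁻ : ∀ {m n} (α : Fin m → Fin n) (x : NodeData F m) {w} →
      OccursAt P (mapData α x) w → ∃ λ u → OccursAt P x u × α u ≡ w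
    occursAt-map⁻ α (labeled f vs) (i , p , refl) =
      lookup vs i , (i , p , refl) , sym (Vec.lookup-map i α vs)

    -- Serves to trace successors backwards: `α` will be the embedding of the result into the
    -- contractum, `β` the redirection applied to nodes of G or K.
    occursAt-transfer : ∀ {m m′ n} {α : Fin m → Fin n} {β : Fin m′ → Fin n}
      (x : NodeData F m) (y : NodeData F m′) → mapData α x ≡ mapData β y →
      ∀ {u} → OccursAt P x u → ∃ λ w → OccursAt P y w × β w ≡ α u
    occursAt-transfer {α = α} {β} x y eq {u} o =
      occursAt-map⁻ β y (subst (λ z → OccursAt P z (α u)) eq (occursAt-map⁺ α x o))

    occursAt⇒⟶ : ∀ {n} (x : NodeData F n) {u} → OccursAt P x u → OccursAt (λ _ _ → ⊤) x u
    occursAt⇒⟶ (labeled f vs) (i , _ , eq) = i , tt , eq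

    occursAt-labeled : ∀ {n} (x : NodeData F n) {u} → OccursAt P x u → ∃ λ f → label x ≡ just f
    occursAt-labeled (labeled f vs) _ = f , refl

  -- Each successor is matched to a position where it occurs; a position determines its node, so at
  -- most `ar f` summands arise.
  occurrences-≤ : ∀ {n} {P : (f : Sym) → Pred (Fin (ar f)) 0ℓ} (P? : ∀ f → Decidable (P f))
    (x : NodeData F n) {f} → label x ≡ just f → (h : Fin n → ℕ) → ∀ D →
    (∀ {u} → OccursAt P x u → h u ≤ D) → sumOver (occursAt? P? x) h ≤ ar f * D
  occurrences-≤ {n} {P} P? (labeled f vs) refl h D h≤D = begin
    sumOver occurs? h              ≤⟨ sum-matching (λ u i → lookup vs i ≡ u) h (λ _ → D)
                                        (λ { refl refl → refl }) positions (elements-unique occurs?) match ⟩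
    sum (map (λ _ → D) positions)      ≡⟨ ℕ.*-identityʳ _ ⟨
    sum (map (λ _ → D) positions) * 1  ≤⟨ sum-map-*-≤ (λ _ → D) 1 D positions
                                            (λ _ → ℕ.≤-reflexive (ℕ.*-identityʳ D)) ⟩
    length positions * D           ≡⟨ cong (λ k → k * D) (length-tabulate {n = ar f} id) ⟩
    ar f * D                       ∎
    where
    open ℕ.≤-Reasoning
    positions : List (Fin (ar f))
    positions = allFin (ar f)

    occurs? : Decidable (OccursAt P (labeled {F} f vs))
    occurs? = occursAt? {F} {P = P} P? (labeled f vs)

    match : ∀ {u} → u ∈ᴸ elements occurs? → ∃ λ i → i ∈ᴸ positions × lookup vs i ≡ u × h u ≤ D
    match u∈ with ∈-elements⁻ occurs? u∈
    ... | o@(i , _ , eq) = i , ∈-allFin i , eq , h≤D o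

  module _ (sep : Separation F) where
    open Separation sep

    ⟶-split : ∀ {n} (x : NodeData F n) {u} → OccursAt (λ _ _ → ⊤) x u →
      OccursAt (λ f i → i ∈ nrm f) x u ⊎ OccursAt (λ f i → i ∉ nrm f) x u
    ⟶-split (labeled f vs) (i , _ , eq) with i ∈? nrm f
    ... | yes i∈ = inj₁ (i , i∈ , eq)
    ... | no  i∉ = inj₂ (i , i∉ , eq)

    constructor-no-nrm : ∀ {n} (x : NodeData F n) →
      (∀ f → label x ≡ just f → f ∈ constructors) → ∀ {u} → ¬ OccursAt (λ f i → i ∈ nrm f) x u
    constructor-no-nrm (labeled f vs) f∈C (i , i∈ , _) = constructor-safe (f∈C f refl) i i∈

  module _ (G : LabeledGraph F) where
    open LabeledGraph G

    no-cycle : ∀ {v w} → v ⟶ w → ¬ (w ⟶* v)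
    no-cycle {v} v⟶w w⟶*v = acyclic v (close v⟶w w⟶*v)
      where
      close : ∀ {x y z} → x ⟶ y → y ⟶* z → x ⟶⁺ z
      close r ε       = Plus.[ r ]
      close r (s ◅ p) = r Plus.∷ close s p

    isConstructorGraph-⟶* : ∀ {v w} → v ⟶* w → IsConstructorGraph G v → IsConstructorGraph G w
    isConstructorGraph-⟶* p c u q = c u (p ◅◅ q)

    depth-⟶* : ∀ {v w} → v ⟶* w → depth↾ G w ≤ depth↾ G v
    depth-⟶* ε = ℕ.≤-refl
    depth-⟶* (_◅_ {v} {u} r p) = ℕ.≤-trans (depth-⟶* p) (ℕ.≤-trans (ℕ.n≤1+n _)
      (proj₂ (proj₂ (longestPath _⟶?_ noetherian v)) _
        (step r (proj₁ (proj₂ (longestPath _⟶?_ noetherian u))))))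

-- The invariant of reachable term graphs

-- The clauses range over all nodes, since every node of a term graph is reachable from its root.
-- `N` bounds the normal part of each single node, not the union of these parts.
record Invariant {F : Signature} (sep : Separation F) (N : ℕ) (G : LabeledGraph F) : Set where
  open LabeledGraph G
  field
    all-labeled     : ∀ v → Labeled v
    nrm-constructor : ∀ {v u} → NrmSucc sep preGraph v u → IsConstructorGraph G u
    nrm-bounded     : ∀ v → card (nrmPart? sep G v) ≤ N

  nrmPart-constructor : ∀ {v u} → NrmPart sep G v u → IsConstructorGraph G u
  nrmPart-constructor (w , s , p) = isConstructorGraph-⟶* G p (nrm-constructor s)

  inTGnrm-acc : ∀ v → Acc (flip _⟶_) v → InTGnrm sep G v
  inTGnrm-acc v (acc rs) = nrm-safe (λ _ → nrm-constructor)
    (λ u s → inTGnrm-acc u (rs (occursAt⇒⟶ (str v) s)))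

  -- A normal edge on the path would lead into a constructor graph containing `x`. Hence the
  -- safe-path condition in the definition of π holds at every node that does not root a constructor
  -- graph.
  non-constructor⇒safePath : ∀ {v x} → v ⟶* x → ¬ IsConstructorGraph G x → SafePath sep G v x
  non-constructor⇒safePath ε ¬c = ε
  non-constructor⇒safePath (_◅_ {v} s p) ¬c with ⟶-split sep (str v) s
  ... | inj₁ n = contradiction (nrmPart-constructor (_ , n , p)) ¬c
  ... | inj₂ t = t ◅ non-constructor⇒safePath p ¬c

inDomain : ∀ {F sep N} (G : TermGraph F) → Invariant sep N (TermGraph.labeledGraph G) → InDomain-π sep G
inDomain G inv = record
  { closed  = λ u _ → all-labeled u
  ; inTGnrm = inTGnrm-acc _ (TermGraph.noetherian G _)
  }
  where open Invariant inv

-- Below the root there are only constructors, which have no normal positions, so the root alone can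
-- have a nonempty normal part.
basic-invariant : ∀ {F} (sep : Separation F) (G : TermGraph F) →
  let open TermGraph G in Closed labeledGraph root → Basic labeledGraph root →
  Invariant sep (card (nrmPart? sep labeledGraph root)) labeledGraph
basic-invariant sep G closed (_ , args) = record
  { all-labeled     = λ v → closed v (reachable v)
  ; nrm-constructor = λ {v} s → nrm-constructor s (reachable v)
  ; nrm-bounded     = λ v → bounded v (reachable v)
  }
  where
  open TermGraph G

  below-root : ∀ {v w} → root ⟶ w → w ⟶* v → ∀ {u} → ¬ NrmSucc sep preGraph v u
  below-root {v} s p = constructor-no-nrm sep (str v) (args _ s v p)

  nrm-constructor : ∀ {v u} → NrmSucc sep preGraph v u → root ⟶* v → IsConstructorGraph labeledGraph u
  nrm-constructor s ε       = args _ (occursAt⇒⟶ (str root) s)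
  nrm-constructor s (t ◅ p) = contradiction s (below-root t p)

  bounded : ∀ v → root ⟶* v → card (nrmPart? sep labeledGraph v) ≤ card (nrmPart? sep labeledGraph root)
  bounded v ε       = ℕ.≤-refl
  bounded v (t ◅ p) = ℕ.≤-trans
    (ℕ.≤-reflexive (card-empty (nrmPart? sep labeledGraph v) λ { _ (_ , s , _) → below-root t p s })) z≤n

-- Matching a constructor rule

module _ {F : Signature} (sep : Separation F) (prec : Precedence F) (K : LabeledGraph F) where
  open LabeledGraph K

  labelsBelow : ∀ {h g} → _⊏pt_ sep prec K h g → LabelsBelow sep prec K h g
  labelsBelow (sub-≡ below _)      = below
  labelsBelow (sub-⊏ below _ _)    = below
  labelsBelow (decomp below _ _ _) = below

  module _ {l : Node} (basic : Basic K l) where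

    -- Hence clause (1) of ⊏pt does not nest at a labeled node: the arguments of l carry only
    -- constructors, which are minimal.
    labeled⇒¬⊏pt-argument : ∀ {h u} → l ⟶ u → Labeled h → ¬ _⊏pt_ sep prec K h u
    labeled⇒¬⊏pt-argument {h} {u} s (f , lab-h) h⊏u with labelsBelow h⊏u h f ε lab-h
    ... | g , lab-u , f⊏g =
      Precedence.constructor-minimal prec (proj₂ basic u s u ε g lab-u) f f⊏g

    -- Only `decomp` is compatible with a normal successor: in `sub-≡` the node `h` would carry a
    -- constructor, and `sub-⊏` fails at a labeled `h`.
    ⊏pt-nrm : ∀ {h v} → _⊏pt_ sep prec K h l → NrmSucc sep preGraph h v → _⊏nrm_ sep prec K v l
    ⊏pt-nrm {h} (sub-≡ _ s) n =
      contradiction n (constructor-no-nrm sep (str h) (proj₂ basic h s h ε))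
    ⊏pt-nrm {h} (sub-⊏ _ s h⊏u) n =
      contradiction h⊏u (labeled⇒¬⊏pt-argument s (occursAt-labeled (str h) n))
    ⊏pt-nrm (decomp _ _ nrm _) n = nrm _ n

    -- The hypothesis excludes `sub-≡`. It holds for nodes outside K↾l, so the relation to `l`
    -- passes along safe edges as long as the nodes to be copied are fresh.
    ⊏pt-safe : ∀ {h v} → ¬ (l ⟶ h) → _⊏pt_ sep prec K h l →
      SafeSucc sep preGraph h v → _⊏pt_ sep prec K v l
    ⊏pt-safe ¬s (sub-≡ _ s) t = contradiction s ¬s
    ⊏pt-safe {h} ¬s (sub-⊏ _ s h⊏u) t =
      contradiction h⊏u (labeled⇒¬⊏pt-argument s (occursAt-labeled (str h) t))
    ⊏pt-safe ¬s (decomp _ _ _ safe) t = safe _ t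

module Match {F : Signature} (sep : Separation F) (prec : Precedence F) (ρ : Triple F)
             (basic : Basic (Triple.K ρ) (Triple.l ρ))
             (r⊏l : _⊏pt_ sep prec (Triple.K ρ) (Triple.r ρ) (Triple.l ρ))
             (G : LabeledGraph F) (φ : LabeledGraph.Node (Triple.K ρ) → LabeledGraph.Node G)
             (isHom : IsHom (Triple.K ρ) G (Triple.l ρ) φ) where
  open Signature F
  open Triple ρ
  open LabeledGraph K
  private
    module G = LabeledGraph G

  f₀ : Sym
  f₀ = proj₁ (proj₁ basic)

  lab-l : lab l ≡ just f₀
  lab-l = proj₁ (proj₂ (proj₁ basic))

  φ-occursAt : ∀ {P : (f : Sym) → Pred (Fin (ar f)) 0ℓ} {v w} → l ⟶* v →
    OccursAt P (str v) w → OccursAt P (G.str (φ v)) (φ w)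
  φ-occursAt {P} {v} {w} p o = subst (λ x → OccursAt P x (φ w))
    (sym (isHom v p (occursAt-labeled (str v) o))) (occursAt-map⁺ φ (str v) o)

  φ-⟶* : ∀ {v w} → l ⟶* v → v ⟶* w → φ v G.⟶* φ w
  φ-⟶* p ε       = ε
  φ-⟶* p (s ◅ q) = φ-occursAt p s ◅ φ-⟶* (p ◅◅ s ◅ ε) q

  φ-nrmPart : ∀ {u} → NrmPart sep K l u → NrmPart sep G (φ l) (φ u)
  φ-nrmPart (w , n , p) = φ w , φ-occursAt ε n , φ-⟶* (occursAt⇒⟶ (str l) n ◅ ε) p

  nrmPart⇒⟶* : ∀ {u} → NrmPart sep K l u → l ⟶* u
  nrmPart⇒⟶* (w , n , p) = occursAt⇒⟶ (str l) n ◅ p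

  lab-φl : G.lab (φ l) ≡ just f₀
  lab-φl = trans (cong label (isHom l ε (f₀ , lab-l))) (trans (label-mapData φ (str l)) lab-l)

  φl-not-constructor : ¬ IsConstructorGraph G (φ l)
  φl-not-constructor c = proj₂ (proj₂ (proj₁ basic)) (c (φ l) ε f₀ lab-φl)

  constructor⇒≢φl : ∀ {x} → IsConstructorGraph G x → x ≢ φ l
  constructor⇒≢φl c refl = φl-not-constructor c

  -- A nonempty path from `l` to `u` is mapped to a nonempty path in the acyclic graph G.
  φ-≢φl : ∀ {u} → l ⟶* u → u ≢ l → φ u ≢ φ l
  φ-≢φl ε       u≢l eq = u≢l refl
  φ-≢φl (s ◅ p) u≢l eq =
    no-cycle G (φ-occursAt ε s) (subst (G._⟶*_ _) eq (φ-⟶* (s ◅ ε) p))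

  -- All labels in K↾r lie strictly below the label `f₀` of `l`, and the precedence is irreflexive.
  ⟶*r⇒≢l : ∀ {u} → r ⟶* u → u ≢ l
  ⟶*r⇒≢l p refl with labelsBelow sep prec K r⊏l l f₀ p lab-l
  ... | g , lab-g , f₀⊏g = IsStrictPartialOrder.irrefl (Precedence.isStrictPartialOrder prec)
    (just-injective (trans (sym lab-l) lab-g)) f₀⊏g

  nrmPart-r⊆nrmPart-l : ∀ {u} → NrmPart sep K r u → NrmPart sep K l u
  nrmPart-r⊆nrmPart-l (w , n , p) with ⊏pt-nrm sep prec K basic r⊏l n
  ... | w′ , n′ , p′ = w′ , n′ , p′ ◅◅ p

-- Maximal sharing

-- ι embeds a graph K into (K↾ρ) ∩ nrm = P↾p, away from the safe successors of ρ.
record NrmEmbedding {F : Signature} (sep : Separation F) (K : PreGraph F) (ρ : PreGraph.Node K)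
                    (P : PreGraph F) (p : PreGraph.Node P) : Set where
  private
    module K = PreGraph K
    module P = PreGraph P
  field
    ι           : K.Node → P.Node
    ι-injective : ∀ {u v} → ι u ≡ ι v → u ≡ v
    ι-str       : ∀ {u} → u ≢ ρ → P.str (ι u) ≡ mapData ι (K.str u)
    ι-nrm       : ∀ {u} → NrmSucc sep K ρ u → p P.⟶ ι u

module _ {F : Signature} (sep : Separation F) (K : PreGraph F) (ρ : PreGraph.Node K) where
  open Signature F
  open Separation sep
  open PreGraph K

  mapData-id : ∀ {n} (x : NodeData F n) → mapData id x ≡ x
  mapData-id unlabeled      = refl
  mapData-id (labeled f vs) = cong (labeled f) (Vec.map-id vs)

  id-embedding : NrmEmbedding sep K ρ K ρ
  id-embedding = record
    { ι           = id
    ; ι-injective = id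
    ; ι-str       = λ {u} _ → sym (mapData-id (str u))
    ; ι-nrm       = occursAt⇒⟶ (str ρ)
    }

  cutSafe-embedding : ∀ f vs → str ρ ≡ labeled f vs →
    NrmEmbedding sep K ρ (cutSafe sep K ρ f vs) (ρ ↑ˡ ar f)
  cutSafe-embedding f vs str-ρ = record
    { ι           = _↑ˡ ar f
    ; ι-injective = ↑ˡ-injective (ar f) _ _
    ; ι-str       = λ {u} u≢ρ → begin
        P.str (u ↑ˡ ar f)           ≡⟨ Vec.lookup-++ˡ updated (replicate (ar f) unlabeled) u ⟩
        lookup updated u            ≡⟨ Vec.lookup∘update′ u≢ρ embedded _ ⟩
        lookup embedded u           ≡⟨ Vec.lookup-map u _ nodes ⟩
        mapData (_↑ˡ ar f) (str u)  ∎
    ; ι-nrm       = λ {u} n → ι-nrm (subst (λ x → OccursAt (λ f i → i ∈ nrm f) x u) str-ρ n)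
    }
    where
    open ≡-Reasoning
    module P = PreGraph (cutSafe sep K ρ f vs)

    args : Vec P.Node (ar f)
    args = tabulate λ i → if does (i ∈? nrm f) then lookup vs i ↑ˡ ar f else order ↑ʳ i

    embedded updated : Vec (NodeData F P.order) order
    embedded = Vec.map (mapData (_↑ˡ ar f)) nodes
    updated  = embedded [ ρ ]≔ labeled f args

    str-root : P.str (ρ ↑ˡ ar f) ≡ labeled f args
    str-root = trans (Vec.lookup-++ˡ updated (replicate (ar f) unlabeled) ρ) (Vec.lookup∘update ρ embedded _)

    ι-nrm : ∀ {u} → OccursAt {F} (λ f i → i ∈ nrm f) (labeled f vs) u → (ρ ↑ˡ ar f) P.⟶ (u ↑ˡ ar f)
    ι-nrm (i , i∈ , refl) = subst (λ x → OccursAt (λ _ _ → ⊤) x (lookup vs i ↑ˡ ar f)) (sym str-root)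
      (i , tt , trans (Vec.lookup∘tabulate _ i) (cong (λ b → if b then lookup vs i ↑ˡ ar f else order ↑ʳ i) (dec-true (i ∈? nrm f) i∈)))

  labeledSafe? : Dec (∃ λ u → SafeSucc sep K ρ u × Labeled u)
  labeledSafe? = any? λ u → safeSucc? sep K ρ u ×-dec labeled? u

  -- As a record, this hypothesis hides its dependence on str ρ, so that str ρ can be abstracted
  -- in the unfolding of ∩nrm.
  record CutsSafe : Set where
    field
      witness : ∃ λ u → SafeSucc sep K ρ u × Labeled u
      decided : labeledSafe? ≡ yes witness

  cutsSafe? : CutsSafe ⊎ ¬ (∃ λ u → SafeSucc sep K ρ u × Labeled u)
  cutsSafe? with labeledSafe? in eq
  ... | yes s = inj₁ (record { witness = s ; decided = eq })
  ... | no ¬s = inj₂ ¬s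

  ∩nrm-embedding : NrmEmbedding sep K ρ (proj₁ (∩nrm sep K ρ)) (proj₂ (∩nrm sep K ρ))
  ∩nrm-embedding with cutsSafe?
  ∩nrm-embedding | inj₁ cuts rewrite CutsSafe.decided cuts with str ρ in str-ρ
  ...   | labeled f vs = cutSafe-embedding f vs str-ρ
  ...   | unlabeled    = id-embedding
  ∩nrm-embedding | inj₂ ¬s with labeledSafe?
  ...   | yes s = contradiction s ¬s
  ...   | no _  = id-embedding

-- Separates the equation of labels from that of successor sequences. It is applied to sequences of
-- the form `Vec.map φ vs`, where `refl` cannot be matched directly.
labeled-injective : ∀ {F : Signature} {n f g} {vs : Vec (Fin n) (Signature.ar F f)} {ws} →
  labeled {F} f vs ≡ labeled g ws →
  Σ[ eq ∈ f ≡ g ] subst (λ h → Vec (Fin n) (Signature.ar F h)) eq vs ≡ ws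
labeled-injective refl = refl , refl

module LeftCount {F : Signature} (sep : Separation F) (prec : Precedence F) (ρ : Triple F)
                 (basic : Basic (Triple.K ρ) (Triple.l ρ))
                 (r⊏l : _⊏pt_ sep prec (Triple.K ρ) (Triple.r ρ) (Triple.l ρ))
                 (G : LabeledGraph F) (φ : LabeledGraph.Node (Triple.K ρ) → LabeledGraph.Node G)
                 (isHom : IsHom (Triple.K ρ) G (Triple.l ρ) φ)
                 {d : ℕ} (conditions : InfRuleConditions sep d ρ) where
  open Signature F
  open Triple ρ
  open LabeledGraph K
  open Match sep prec ρ basic r⊏l G φ isHom
  open InfRuleConditions conditions
  private
    module G = LabeledGraph G
    P : PreGraph F
    P = proj₁ (∩nrm sep preGraph l)
    module P = PreGraph P

  open NrmEmbedding (∩nrm-embedding sep preGraph l)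

  -- Closedness lets `isHom` determine the content of `φ u`; lying strictly below `l` makes `ι-str`
  -- applicable. Both properties pass to successors.
  ClosedArgument : Node → Set
  ClosedArgument u = (∃ λ w → l ⟶ w × w ⟶* u) × Closed K u

  closedArgument-⟶ : ∀ {u v} → ClosedArgument u → u ⟶ v → ClosedArgument v
  closedArgument-⟶ ((w , s , p) , closed) t = (w , s , p ◅◅ t ◅ ε) , λ x q → closed x (t ◅ q)

  closedArgument-≢l : ∀ {u} → ClosedArgument u → u ≢ l
  closedArgument-≢l ((w , s , p) , _) refl = no-cycle K s p

  G-str : ∀ {u} → ClosedArgument u → G.str (φ u) ≡ mapData φ (str u)
  G-str {u} ((w , s , p) , closed) = isHom u (s ◅ p) (closed u ε)

  -- Both nodes have the content of their common image up to φ, hence equal labels and successors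
  -- that φ identifies pairwise. Induction along the edges yields the arguments of the term,
  -- evaluated in `P` because maximal sharing is assumed there.
  common-term : ∀ {u v} → Acc (flip _⟶_) u → ClosedArgument u → ClosedArgument v → φ u ≡ φ v →
    ∃ λ t → _⇓_ P (ι u) t × _⇓_ P (ι v) t
  common-term {u} {v} (acc rs) cu cv φu≡φv =
    go (str u) (str v) refl refl (trans (sym (G-str cu)) (trans (cong G.str φu≡φv) (G-str cv)))
    where
    go : ∀ x y → str u ≡ x → str v ≡ y → mapData φ (str u) ≡ mapData φ (str v) →
      ∃ λ t → _⇓_ P (ι u) t × _⇓_ P (ι v) t
    go unlabeled _ eu _ _ with proj₂ cu u ε
    ... | _ , lab-u = contradiction (trans (sym (cong label eu)) lab-u) λ ()
    go (labeled f vs) unlabeled _ ev _ with proj₂ cv v ε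
    ... | _ , lab-v = contradiction (trans (sym (cong label ev)) lab-v) λ ()
    go (labeled f vs) (labeled g ws) eu ev eq
      with labeled-injective (trans (sym (cong (mapData φ) eu)) (trans eq (cong (mapData φ) ev)))
    ... | refl , φvs≡φws = app f (tabulate (proj₁ ∘ args)) , evaluates eu cu (proj₁ ∘ proj₂ ∘ args)
                                                           , evaluates ev cv (proj₂ ∘ proj₂ ∘ args)
      where
      successor : ∀ {x xs} → str x ≡ labeled f xs → ∀ i → x ⟶ lookup xs i
      successor {xs = xs} ex i = subst (λ z → OccursAt (λ _ _ → ⊤) z (lookup xs i)) (sym ex) (i , tt , refl)

      args : ∀ i → ∃ λ t → _⇓_ P (ι (lookup vs i)) t × _⇓_ P (ι (lookup ws i)) t
      args i = common-term (rs (successor eu i)) (closedArgument-⟶ cu (successor eu i))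
        (closedArgument-⟶ cv (successor ev i))
        (trans (sym (Vec.lookup-map i φ vs)) (trans (cong (λ z → lookup z i) φvs≡φws) (Vec.lookup-map i φ ws)))

      evaluates : ∀ {x xs} {ts : Fin (ar f) → Term F P.Node} → str x ≡ labeled f xs → ClosedArgument x →
        (∀ i → _⇓_ P (ι (lookup xs i)) (ts i)) → _⇓_ P (ι x) (app f (tabulate ts))
      evaluates {xs = xs} {ts} ex cx ⇓ts =
        app (trans (ι-str (closedArgument-≢l cx)) (cong (mapData ι) ex))
          λ i → subst₂ (_⇓_ P) (sym (Vec.lookup-map i ι xs)) (sym (Vec.lookup∘tabulate ts i)) (⇓ts i)

  -- Counting the nodes of the two sides of an infinite-family rule

  LabeledNrmPart : Node → Set
  LabeledNrmPart u = NrmPart sep K l u × Labeled u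

  labeledNrmPart? : Decidable LabeledNrmPart
  labeledNrmPart? u = nrmPart? sep K l u ×-dec labeled? u

  Small : Node → Set
  Small u = (NrmSucc sep preGraph l u × Unlabeled u) ⊎ SafePart sep K l u

  small? : Decidable Small
  small? u = (nrmSucc? sep preGraph l u ×-dec unlabeled? u) ⊎-dec safePart? sep K l u

  nrmPart-closed : ∀ {w u} → NrmSucc sep preGraph l w → w ⟶* u → Labeled u → Closed K u
  nrmPart-closed {w} n ε        lab-w = closed w n lab-w
  nrmPart-closed {w} n (s ◅ p) _     v q =
    closed w n (occursAt-labeled (str w) s) v (s ◅ p ◅◅ q)

  -- An unlabeled node strictly below a normal argument would contradict condition (ii), so it must
  -- be a normal argument itself and is counted in (iii).
  nrmPart-split : ∀ {u} → NrmPart sep K l u → Small u ⊎ LabeledNrmPart u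
  nrmPart-split {u} (w , n , p) with lab u in lab-u
  nrmPart-split {u} (w , n , p)           | just f  = inj₂ ((w , n , p) , f , refl)
  nrmPart-split {u} (.u , n , ε)          | nothing = inj₁ (inj₁ (n , refl))
  nrmPart-split {u} (w , n , p@(s ◅ _)) | nothing with closed w n (occursAt-labeled (str w) s) u p
  ... | _ , lab-u′ = contradiction (trans (sym lab-u) lab-u′) λ ()

  labeledNrmPart-closedArgument : ∀ {u} → LabeledNrmPart u → ClosedArgument u
  labeledNrmPart-closedArgument ((w , n , p) , lab-u) =
    (w , occursAt⇒⟶ (str l) n , p) , nrmPart-closed n p lab-u

  -- The hypothesis keeps the path strictly below `l`; only at `l` may the cut have changed the
  -- successors.
  ι-reachable : ∀ {w u} → (∃ λ v → l ⟶ v × v ⟶* w) → w ⟶* u → ι w P.⟶* ι u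
  ι-reachable _           ε = ε
  ι-reachable {w} (v , s , p) (_◅_ {j = x} t q) =
    subst (λ z → OccursAt (λ _ _ → ⊤) z (ι x)) (sym (ι-str λ { refl → no-cycle K s p }))
      (occursAt-map⁺ ι (str w) t)
    ◅ ι-reachable (v , s , p ◅◅ t ◅ ε) q

  φ-injective : ∀ {u v} → LabeledNrmPart u → LabeledNrmPart v → φ u ≡ φ v → u ≡ v
  φ-injective {u} {v} Lu Lv φu≡φv with common-term (noetherian u) (labeledNrmPart-closedArgument Lu)
                                      (labeledNrmPart-closedArgument Lv) φu≡φv
  ... | t , u⇓t , v⇓t = ι-injective (shared (ι u) (ι v) t (reach Lu) (reach Lv) u⇓t v⇓t)
    where
    reach : ∀ {x} → LabeledNrmPart x → proj₂ (∩nrm sep preGraph l) P.⟶* ι x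
    reach ((w , n , p) , _) = ι-nrm n ◅ ι-reachable (w , occursAt⇒⟶ (str l) n , ε) p

  card-labeledNrmPart : card labeledNrmPart? ≤ card (nrmPart? sep G (φ l))
  card-labeledNrmPart = card-matching labeledNrmPart? (nrmPart? sep G (φ l))
    -- The relation records membership, since φ is shown injective only on labeled nodes of the
    -- normal part.
    (λ u y → LabeledNrmPart u × φ u ≡ y)
    (λ { (Lu , refl) (Lv , eq) → φ-injective Lu Lv (sym eq) })
    λ {u} Lu → φ u , φ-nrmPart (proj₁ Lu) , Lu , refl

  -- Covers K↾l apart from `l`. Repetitions are harmless because only the length enters, as an upper
  -- bound.
  arguments : List Node
  arguments = elements small? ++ elements labeledNrmPart?

  ∈-arguments : ∀ {u} → Small u ⊎ LabeledNrmPart u → u ∈ᴸ arguments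
  ∈-arguments (inj₁ Su) = ∈-++⁺ˡ (∈-elements⁺ small? Su)
  ∈-arguments (inj₂ Lu) = ∈-++⁺ʳ (elements small?) (∈-elements⁺ labeledNrmPart? Lu)

  ∈-l∷arguments : ∀ {u} → l ⟶* u → u ∈ᴸ l ∷ arguments
  ∈-l∷arguments ε = here refl
  ∈-l∷arguments (s ◅ p) with ⟶-split sep (str l) s
  ... | inj₁ n = there (∈-arguments (nrmPart-split (_ , n , p)))
  ... | inj₂ t = there (∈-arguments (inj₁ (inj₂ (_ , t , p))))

  card-⊆ : ∀ {P : Pred Node 0ℓ} (P? : Decidable P) {us} → (∀ {u} → P u → u ∈ᴸ us) → card P? ≤ length us
  card-⊆ P? P⊆us = length-matching _≡_ (λ { refl refl → refl }) _ (elements-unique P?)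
    λ {u} u∈ → u , P⊆us (∈-elements⁻ P? u∈) , refl

  length-arguments : length arguments ≤ d + card (nrmPart? sep G (φ l))
  length-arguments = ℕ.≤-trans (ℕ.≤-reflexive (length-++ (elements small?))) (ℕ.+-mono-≤ small card-labeledNrmPart)

  -- `arguments` bounds both terms of (iv): K↾l is covered once `l` is added, and the normal part of
  -- `r` lies within that of `l`. This explains the factor 2 and the summand 1.
  size-r-≤ : ∀ {N} → card (nrmPart? sep G (φ l)) ≤ N → size↾ K r ≤ 1 + 2 * (N + d)
  size-r-≤ {N} bounded = begin
    size↾ K r                                        ≤⟨ growth ⟩
    size↾ K l + card (nrmPart? sep K r)              ≤⟨ ℕ.+-mono-≤ (card-⊆ (l ⟶*?_) ∈-l∷arguments)
                                                          (card-⊆ (nrmPart? sep K r) (∈-arguments ∘ nrmPart-split ∘ nrmPart-r⊆nrmPart-l)) ⟩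
    suc (length arguments) + length arguments        ≤⟨ s≤s (ℕ.+-mono-≤ length-≤ length-≤) ⟩
    1 + ((d + N) + (d + N))                          ≡⟨ rearrange d N ⟩
    1 + 2 * (N + d)                                  ∎
    where
    open ℕ.≤-Reasoning
    length-≤ : length arguments ≤ d + N
    length-≤ = ℕ.≤-trans length-arguments (ℕ.+-monoʳ-≤ d bounded)

    rearrange : ∀ d N → 1 + ((d + N) + (d + N)) ≡ 1 + 2 * (N + d)
    rearrange = solve-∀

-- One rewrite step

module RewriteStep {F : Signature} (sep : Separation F) (prec : Precedence F) (ρ : Triple F)
                   (isRule : IsRule ρ) (basic : Basic (Triple.K ρ) (Triple.l ρ))
                   (r⊏l : _⊏pt_ sep prec (Triple.K ρ) (Triple.r ρ) (Triple.l ρ))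
                   (G H : TermGraph F) (φ : LabeledGraph.Node (Triple.K ρ) → TermGraph.Node G)
                   (isHom : IsHom (Triple.K ρ) (TermGraph.labeledGraph G) (Triple.l ρ) φ)
                   (result : H ≅ contractum ρ G φ ↾ contractumRoot ρ G φ)
                   {N : ℕ} (invariant : Invariant sep N (TermGraph.labeledGraph G)) where
  open Signature F
  open Triple ρ
  open LabeledGraph K
  open Match sep prec ρ basic r⊏l (TermGraph.labeledGraph G) φ isHom
  open Invariant invariant
  open _≅_↾_ result using (θ; injective)
  private
    module G = TermGraph G
    module H = TermGraph H
    module P = PreGraph (contractum ρ G φ)

  old : G.Node → P.Node
  old x = x ↑ˡ order

  new : Node → P.Node
  new h = G.order ↑ʳ h

  old-injective : ∀ {x y} → old x ≡ old y → x ≡ y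
  old-injective = ↑ˡ-injective order _ _

  old≢new : ∀ {x h} → old x ≢ new h
  old≢new {x} {h} eq with trans (sym (splitAt-↑ˡ G.order x order))
                                (trans (cong (splitAt G.order) eq) (splitAt-↑ʳ G.order order h))
  ... | ()

  built-old : ∀ {u} → l ⟶* u → built ρ G φ u ≡ old (φ u)
  built-old {u} p = cong (λ b → if b then old (φ u) else new u) (dec-true (l ⟶*? u) p)

  built-new : ∀ {u} → ¬ (l ⟶* u) → built ρ G φ u ≡ new u
  built-new {u} ¬p = cong (λ b → if b then old (φ u) else new u) (dec-false (l ⟶*? u) ¬p)

  redirect-≢ : ∀ {c} → c ≢ old (φ l) → redirect ρ G φ c ≡ c
  redirect-≢ {c} c≢ = cong (λ b → if b then built ρ G φ r else c) (dec-false (c ≟ old (φ l)) c≢)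

  redirect-φl : redirect ρ G φ (old (φ l)) ≡ built ρ G φ r
  redirect-φl = cong (λ b → if b then built ρ G φ r else old (φ l)) (dec-true (old (φ l) ≟ old (φ l)) refl)

  redirect-old : ∀ {x} → x ≢ φ l → redirect ρ G φ (old x) ≡ old x
  redirect-old x≢φl = redirect-≢ (x≢φl ∘ old-injective)

  -- The nodes that survive garbage collection: nodes of G other than the redex root, and copies of
  -- nodes of K↾r outside K↾l. Recording the relation to `l` in `fresh` makes the classification
  -- inductive along edges.
  data Origin (c : P.Node) : Set where
    kept  : ∀ {x} → x ≢ φ l → c ≡ old x → Origin c
    fresh : ∀ {h} → ¬ (l ⟶* h) → r ⟶* h → _⊏pt_ sep prec K h l → c ≡ new h → Origin c

  redirect-origin : ∀ {c} → Origin c → redirect ρ G φ c ≡ c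
  redirect-origin (kept x≢φl refl)    = redirect-old x≢φl
  redirect-origin (fresh _ _ _ refl) = redirect-≢ (old≢new ∘ sym)

  origin-built-old : ∀ {h} → r ⟶* h → l ⟶* h → Origin (built ρ G φ h)
  origin-built-old q p = kept (φ-≢φl p (⟶*r⇒≢l q)) (built-old p)

  origin-built : ∀ {h} → r ⟶* h → _⊏pt_ sep prec K h l → Origin (built ρ G φ h)
  origin-built {h} q h⊏l = go (l ⟶*? h)
    where
    go : Dec (l ⟶* h) → Origin (built ρ G φ h)
    go (yes p) = origin-built-old q p
    go (no ¬p) = fresh ¬p q h⊏l (built-new ¬p)

  origin-redirect : ∀ {c} → Origin c → Origin (redirect ρ G φ c)
  origin-redirect o = subst Origin (sym (redirect-origin o)) o

  origin-redirect-old : ∀ x → Origin (redirect ρ G φ (old x))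
  origin-redirect-old x with x ≟ φ l
  ... | yes refl = subst Origin (sym redirect-φl) (origin-built ε r⊏l)
  ... | no x≢φl  = kept x≢φl (redirect-old x≢φl)

  -- Tracing the result back to the graph and the rule

  str-old : ∀ {v x} → θ v ≡ old x → mapData θ (H.str v) ≡ mapData (redirect ρ G φ ∘ old) (G.str x)
  str-old {v} {x} eq = begin
    mapData θ (H.str v)                            ≡⟨ _≅_↾_.str result v ⟨
    P.str (θ v)                                    ≡⟨ cong P.str eq ⟩
    P.str (old x)                                  ≡⟨ Vec.lookup-++ˡ (Vec.map (mapData (redirect ρ G φ ∘ old)) G.nodes) _ x ⟩
    lookup (Vec.map _ G.nodes) x                   ≡⟨ Vec.lookup-map x _ G.nodes ⟩
    mapData (redirect ρ G φ ∘ old) (G.str x)       ∎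
    where open ≡-Reasoning

  str-new : ∀ {v h} → θ v ≡ new h → mapData θ (H.str v) ≡ mapData (redirect ρ G φ ∘ built ρ G φ) (str h)
  str-new {v} {h} eq = begin
    mapData θ (H.str v)                              ≡⟨ _≅_↾_.str result v ⟨
    P.str (θ v)                                      ≡⟨ cong P.str eq ⟩
    P.str (new h)                                    ≡⟨ Vec.lookup-++ʳ (Vec.map (mapData (redirect ρ G φ ∘ old)) G.nodes) _ h ⟩
    lookup (Vec.map _ nodes) h                       ≡⟨ Vec.lookup-map h _ nodes ⟩
    mapData (redirect ρ G φ ∘ built ρ G φ) (str h)   ∎
    where open ≡-Reasoning

  lab-old : ∀ {v x} → θ v ≡ old x → H.lab v ≡ G.lab x
  lab-old {v} {x} eq = label-transfer (H.str v) (G.str x) (str-old eq)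

  lab-new : ∀ {v h} → θ v ≡ new h → H.lab v ≡ lab h
  lab-new {v} {h} eq = label-transfer (H.str v) (str h) (str-new eq)

  module _ {Q : (f : Sym) → Pred (Fin (ar f)) 0ℓ} where

    successor-old : ∀ {v x w} → θ v ≡ old x → OccursAt Q (H.str v) w →
      ∃ λ y → OccursAt Q (G.str x) y × redirect ρ G φ (old y) ≡ θ w
    successor-old {v} {x} eq = occursAt-transfer (H.str v) (G.str x) (str-old eq)

    successor-new : ∀ {v h w} → θ v ≡ new h → OccursAt Q (H.str v) w →
      ∃ λ u → OccursAt Q (str h) u × redirect ρ G φ (built ρ G φ u) ≡ θ w
    successor-new {v} {h} eq = occursAt-transfer (H.str v) (str h) (str-new eq)

  -- From a fresh node, a normal edge enters the normal part of `l` and hence a kept node, while a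
  -- safe edge preserves the relation to `l`. An edge into the redex root has become an edge to the
  -- image of `r`.
  origin-⟶ : ∀ {v w} → Origin (θ v) → v H.⟶ w → Origin (θ w)
  origin-⟶ (kept _ eq) s with successor-old eq s
  ... | y , _ , eq′ = subst Origin eq′ (origin-redirect-old y)
  origin-⟶ (fresh {h} ¬p q h⊏l eq) s with successor-new eq s
  ... | u , t , eq′ with ⟶-split sep (str h) t
  ...   | inj₁ n = subst Origin eq′ (origin-redirect
            (origin-built-old (q ◅◅ t ◅ ε) (nrmPart⇒⟶* (⊏pt-nrm sep prec K basic h⊏l n))))
  ...   | inj₂ t′ = subst Origin eq′ (origin-redirect
            (origin-built (q ◅◅ t ◅ ε) (⊏pt-safe sep prec K basic (λ l⟶h → ¬p (l⟶h ◅ ε)) h⊏l t′)))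

  origin-⟶* : ∀ {v w} → Origin (θ v) → v H.⟶* w → Origin (θ w)
  origin-⟶* o ε       = o
  origin-⟶* o (s ◅ p) = origin-⟶* (origin-⟶ o s) p

  origin : ∀ v → Origin (θ v)
  origin v = origin-⟶* (subst Origin (sym (_≅_↾_.root result)) (origin-redirect-old G.root)) (H.reachable v)

  -- The redex root has a defined label, so no edge inside a constructor graph is redirected.
  constructor-successor : ∀ {v x w} → IsConstructorGraph G.labeledGraph x → θ v ≡ old x → v H.⟶ w →
    ∃ λ y → x G.⟶ y × θ w ≡ old y
  constructor-successor c eq s with successor-old eq s
  ... | y , t , eq′ = y , t , trans (sym eq′)
    (redirect-old (constructor⇒≢φl (isConstructorGraph-⟶* G.labeledGraph (t ◅ ε) c)))

  constructor-⟶* : ∀ {v x w} → IsConstructorGraph G.labeledGraph x → θ v ≡ old x → v H.⟶* w →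
    ∃ λ y → x G.⟶* y × θ w ≡ old y
  constructor-⟶* c eq ε = _ , ε , eq
  constructor-⟶* c eq (s ◅ p) =
    let y , t , eq′ = constructor-successor c eq s
        z , q , eq″ = constructor-⟶* (isConstructorGraph-⟶* G.labeledGraph (t ◅ ε) c) eq′ p
    in z , t ◅ q , eq″

  constructor-old : ∀ {v x} → θ v ≡ old x → IsConstructorGraph G.labeledGraph x →
    IsConstructorGraph H.labeledGraph v
  constructor-old eq c w p f lab-w with constructor-⟶* c eq p
  ... | y , q , eq′ = c y q f (trans (sym (lab-old eq′)) lab-w)

  path-old : ∀ {v x k} → IsConstructorGraph G.labeledGraph x → θ v ≡ old x → Path H._⟶_ v k → Path G._⟶_ x k
  path-old c eq stop = stop
  path-old c eq (step s p) =
    let _ , t , eq′ = constructor-successor c eq s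
    in step t (path-old (isConstructorGraph-⟶* G.labeledGraph (t ◅ ε) c) eq′ p)

  depth-old : ∀ {v x} → IsConstructorGraph G.labeledGraph x → θ v ≡ old x →
    depth↾ H.labeledGraph v ≤ depth↾ G.labeledGraph x
  depth-old {v} {x} c eq = proj₂ (proj₂ (longestPath G._⟶?_ G.noetherian x)) _
    (path-old c eq (proj₁ (proj₂ (longestPath H._⟶?_ H.noetherian v))))

  nrm-old : ∀ {v x w} → θ v ≡ old x → NrmSucc sep H.preGraph v w →
    ∃ λ y → NrmSucc sep G.preGraph x y × θ w ≡ old y
  nrm-old eq n with successor-old eq n
  ... | y , n′ , eq′ = y , n′ , trans (sym eq′) (redirect-old (constructor⇒≢φl (nrm-constructor n′)))

  -- The normal successors of `h` lie in the normal part of `l`, so `built` sends them to their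
  -- images under φ. These root constructor graphs and escape redirection.
  nrm-new : ∀ {v h w} → _⊏pt_ sep prec K h l → θ v ≡ new h → NrmSucc sep H.preGraph v w →
    ∃ λ y → NrmPart sep G.labeledGraph (φ l) y × θ w ≡ old y
  nrm-new h⊏l eq n with successor-new eq n
  ... | u , n′ , eq′ with ⊏pt-nrm sep prec K basic h⊏l n′
  ...   | part = φ u , φ-nrmPart part , trans (sym eq′)
          (trans (cong (redirect ρ G φ) (built-old (nrmPart⇒⟶* part)))
                 (redirect-old (constructor⇒≢φl (nrmPart-constructor (φ-nrmPart part)))))

  old-left-injective : ∀ {u v y} → θ u ≡ old y → θ v ≡ old y → u ≡ v
  old-left-injective eq eq′ = injective (trans eq (sym eq′))

  -- The variables of a right-hand side occur on the left.
  lab-fresh : ∀ {h} → ¬ (l ⟶* h) → r ⟶* h → Labeled h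
  lab-fresh {h} ¬p q with lab h in lab-h
  ... | just f  = f , refl
  ... | nothing = contradiction (IsRule.variables isRule h q lab-h) ¬p

  -- The normal part of a node of H injects into the normal part of one node of G: its origin if it
  -- is kept, the redex root if it is fresh. So `N` does not grow.
  preserved : Invariant sep N H.labeledGraph
  preserved = record
    { all-labeled     = λ v → all-labeled′ (origin v)
    ; nrm-constructor = λ {v} → nrm-constructor′ (origin v)
    ; nrm-bounded     = λ v → nrm-bounded′ (origin v)
    }
    where
    all-labeled′ : ∀ {v} → Origin (θ v) → H.Labeled v
    all-labeled′ (kept {x} _ eq) with all-labeled x
    ... | f , lab-x = f , trans (lab-old eq) lab-x
    all-labeled′ (fresh ¬p q _ eq) with lab-fresh ¬p q
    ... | f , lab-h = f , trans (lab-new eq) lab-h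

    nrm-constructor′ : ∀ {v u} → Origin (θ v) → NrmSucc sep H.preGraph v u → IsConstructorGraph H.labeledGraph u
    nrm-constructor′ (kept _ eq) n =
      let _ , n′ , eq′ = nrm-old eq n in constructor-old eq′ (nrm-constructor n′)
    nrm-constructor′ (fresh _ _ h⊏l eq) n =
      let _ , part , eq′ = nrm-new h⊏l eq n in constructor-old eq′ (nrmPart-constructor part)

    nrm-bounded′ : ∀ {v} → Origin (θ v) → card (nrmPart? sep H.labeledGraph v) ≤ N
    nrm-bounded′ {v} (kept {x} _ eq) = ℕ.≤-trans
      (card-matching (nrmPart? sep H.labeledGraph v) (nrmPart? sep G.labeledGraph x)
        (λ u y → θ u ≡ old y) old-left-injective match)
      (nrm-bounded x)
      where
      match : ∀ {u} → NrmPart sep H.labeledGraph v u → ∃ λ y → NrmPart sep G.labeledGraph x y × θ u ≡ old y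
      match (w , n , p) =
        let y , n′ , eq′ = nrm-old eq n
            z , q , eq″ = constructor-⟶* (nrm-constructor n′) eq′ p
        in z , (y , n′ , q) , eq″
    nrm-bounded′ {v} (fresh _ _ h⊏l eq) = ℕ.≤-trans
      (card-matching (nrmPart? sep H.labeledGraph v) (nrmPart? sep G.labeledGraph (φ l))
        (λ u y → θ u ≡ old y) old-left-injective match)
      (nrm-bounded (φ l))
      where
      match : ∀ {u} → NrmPart sep H.labeledGraph v u → ∃ λ y → NrmPart sep G.labeledGraph (φ l) y × θ u ≡ old y
      match (w , n , p) =
        let y , (y₀ , n₀ , q₀) , eq′ = nrm-new h⊏l eq n
            z , q , eq″ = constructor-⟶* (nrmPart-constructor (y₀ , n₀ , q₀)) eq′ p
        in z , (y₀ , n₀ , q₀ ◅◅ q) , eq″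

  -- Weights of kept and fresh nodes

  module _ {d ℓ : ℕ} (ar≤d : ∀ f → ar f ≤ d) (0<ℓ : 0 < ℓ) (d≤ℓ : d ≤ ℓ)
           (size-r≤ : size↾ K r ≤ 1 + ℓ) where
    open Precedence prec

    D : ℕ
    D = sumOver (nrmSucc? sep G.preGraph (φ l)) (depth↾ G.labeledGraph)

    -- Besides the label, `pj` depends only on normal arguments; redirection can affect only safe
    -- ones.
    pj-old : ∀ {v x} → θ v ≡ old x → pj sep prec ℓ H.labeledGraph v ≤ pj sep prec ℓ G.labeledGraph x
    pj-old {v} {x} eq = ℕ.*-mono-≤ (ℕ.≤-reflexive (cong (maybe _ 0) (lab-old eq)))
      (s≤s (sumOver-matching (nrmSucc? sep H.preGraph v) (nrmSucc? sep G.preGraph x)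
        (λ u y → θ u ≡ old y) old-left-injective _ _
        λ n → let y , n′ , eq′ = nrm-old eq n in y , n′ , eq′ , depth-old (nrm-constructor n′) eq′))

    -- An upper bound for `pj` at a copy of `h`: there are at most `d` normal arguments, each of
    -- depth at most `D`. The default 0 is not reached at fresh nodes, which are labeled.
    weight : Node → ℕ
    weight h = maybe (λ f → (1 + ℓ) ^ (2 * rk f)) 0 (lab h) * (1 + d * D)

    nrm-depth-new : ∀ {v h w} → _⊏pt_ sep prec K h l → θ v ≡ new h → NrmSucc sep H.preGraph v w →
      depth↾ H.labeledGraph w ≤ D
    nrm-depth-new {w = w} h⊏l eq n =
      let y , (y₀ , n₀ , q₀) , eq′ = nrm-new h⊏l eq n in begin
        depth↾ H.labeledGraph w   ≤⟨ depth-old (nrmPart-constructor (y₀ , n₀ , q₀)) eq′ ⟩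
        depth↾ G.labeledGraph y   ≤⟨ depth-⟶* G.labeledGraph q₀ ⟩
        depth↾ G.labeledGraph y₀  ≤⟨ ≤-sumOver (nrmSucc? sep G.preGraph (φ l)) (depth↾ G.labeledGraph) n₀ ⟩
        D                         ∎
      where open ℕ.≤-Reasoning

    pj-new : ∀ {v h} → _⊏pt_ sep prec K h l → θ v ≡ new h → pj sep prec ℓ H.labeledGraph v ≤ weight h
    pj-new {v} h⊏l eq = ℕ.*-mono-≤ (ℕ.≤-reflexive (cong (maybe _ 0) (lab-new eq))) (s≤s nrm-depths)
      where
      nrm-depths : sumOver (nrmSucc? sep H.preGraph v) (depth↾ H.labeledGraph) ≤ d * D
      nrm-depths = let f , lab-v = Invariant.all-labeled preserved v in ℕ.≤-trans
        (occurrences-≤ (λ f i → i ∈? Separation.nrm sep f) (H.str v) lab-v (depth↾ H.labeledGraph) D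
          (nrm-depth-new h⊏l eq))
        (ℕ.*-monoˡ-≤ D (ar≤d f))

    Fresh : Node → Set
    Fresh h = r ⟶* h × ¬ (l ⟶* h)

    fresh? : Decidable Fresh
    fresh? h = (r ⟶*? h) ×-dec ¬? (l ⟶*? h)

    -- The rank drops by at least 1 and the exponent is twice the rank, which leaves room for two
    -- factors 1 + ℓ.
    weight-fresh : ∀ {h} → Fresh h →
      weight h * ((1 + ℓ) * (1 + ℓ)) ≤ (1 + ℓ) ^ (2 * rk f₀) * (1 + d * D)
    weight-fresh {h} (q , ¬p) =
      let f , lab-h = lab-fresh ¬p q
          g , lab-l′ , f⊏g = labelsBelow sep prec K r⊏l h f q lab-h
          f⊏f₀ = subst (f ⊏_) (just-injective (trans (sym lab-l′) lab-l)) f⊏g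
      in begin
        weight h * (X * X)                                ≡⟨ cong (λ m → maybe (λ f → X ^ (2 * rk f)) 0 m * (1 + d * D) * (X * X)) lab-h ⟩
        X ^ (2 * rk f) * (1 + d * D) * (X * X)            ≡⟨ rearrange (X ^ (2 * rk f)) (1 + d * D) X ⟩
        X * (X * X ^ (2 * rk f)) * (1 + d * D)            ≡⟨ cong (λ k → X ^ k * (1 + d * D)) (ℕ.*-suc 2 (rk f)) ⟨
        X ^ (2 * suc (rk f)) * (1 + d * D)                ≤⟨ ℕ.*-monoˡ-≤ (1 + d * D) (ℕ.^-monoʳ-≤ X (ℕ.*-monoʳ-≤ 2 (rk-mono f⊏f₀))) ⟩
        X ^ (2 * rk f₀) * (1 + d * D)                     ∎
      where
      open ℕ.≤-Reasoning
      X : ℕ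
      X = 1 + ℓ

      rearrange : ∀ a b x → a * b * (x * x) ≡ x * (x * a) * b
      rearrange = solve-∀

    -- Of the two spare factors `X`, one pays for the number of fresh nodes and the other for
    -- replacing `1 + d * D` by `1 + D`.
    total-weight<pj : sumOver fresh? weight < pj sep prec ℓ G.labeledGraph (φ l)
    total-weight<pj rewrite lab-φl = ℕ.*-cancelʳ-< (X * X) (sumOver fresh? weight) (E * (1 + D)) (begin-strict
      sumOver fresh? weight * (X * X)  ≤⟨ sum-map-*-≤ weight (X * X) (E * (1 + d * D)) (elements fresh?)
                                            (weight-fresh ∘ ∈-elements⁻ fresh?) ⟩
      card fresh? * (E * (1 + d * D))  ≤⟨ ℕ.*-monoˡ-≤ (E * (1 + d * D)) (ℕ.≤-trans card-fresh size-r≤) ⟩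
      X * (E * (1 + d * D))            <⟨ ℕ.*-monoʳ-< X (ℕ.*-monoʳ-< E {{ℕ.m^n≢0 X (2 * rk f₀)}} slack) ⟩
      X * (E * (X * (1 + D)))          ≡⟨ rearrange X E (1 + D) ⟩
      E * (1 + D) * (X * X)            ∎)
      where
      open ℕ.≤-Reasoning
      X E : ℕ
      X = 1 + ℓ
      E = X ^ (2 * rk f₀)

      card-fresh : card fresh? ≤ size↾ K r
      card-fresh = card-matching fresh? (r ⟶*?_) _≡_ (λ { refl refl → refl }) λ {h} (q , _) → h , q , refl

      slack : 1 + d * D < X * (1 + D)
      -- Positivity of `ℓ` makes the inequality strict even when `D` is 0.
      slack = begin-strict
        1 + d * D              <⟨ s≤s (ℕ.m<n+m (d * D) 0<ℓ) ⟩
        1 + (ℓ + d * D)        ≤⟨ s≤s (ℕ.+-monoʳ-≤ ℓ (ℕ.*-monoˡ-≤ D d≤ℓ)) ⟩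
        1 + (ℓ + ℓ * D)        ≤⟨ ℕ.m≤n+m _ D ⟩
        D + (1 + (ℓ + ℓ * D))  ≡⟨ expand D ℓ ⟩
        X * (1 + D)            ∎
        where
        expand : ∀ D ℓ → D + (1 + (ℓ + ℓ * D)) ≡ (1 + ℓ) * (1 + D)
        expand = solve-∀

      rearrange : ∀ x e y → x * (e * (x * y)) ≡ e * y * (x * x)
      rearrange = solve-∀

    -- Comparing the potentials before and after the step

    Counted : (G : TermGraph F) → TermGraph.Node G → Set
    Counted G v = SafePath sep (TermGraph.labeledGraph G) (TermGraph.root G) v
                  × ¬ IsConstructorGraph (TermGraph.labeledGraph G) v

    counted? : (G : TermGraph F) → Decidable (Counted G)
    counted? G v = safePath? sep (TermGraph.labeledGraph G) (TermGraph.root G) v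
                   ×-dec ¬? (isConstructorGraph? (TermGraph.labeledGraph G) v)

    counted-G : ∀ {x} → ¬ IsConstructorGraph G.labeledGraph x → Counted G x
    counted-G {x} ¬c = non-constructor⇒safePath (G.reachable x) ¬c , ¬c

    -- nothing stands for the contracted redex φ l, which has no counterpart in H.
    Matched : Maybe H.Node → G.Node ⊎ Node → Set
    Matched nothing  (inj₁ x) = x ≡ φ l
    Matched nothing  (inj₂ h) = ⊥
    Matched (just v) (inj₁ x) = x ≢ φ l × θ v ≡ old x
    Matched (just v) (inj₂ h) = θ v ≡ new h

    matched-injective : ∀ {a a′ b} → Matched a b → Matched a′ b → a ≡ a′
    matched-injective {nothing} {nothing} {inj₁ x} _          _            = refl
    matched-injective {nothing} {just _}  {inj₁ x} x≡φl       (x≢φl , _)   = contradiction x≡φl x≢φl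
    matched-injective {just _}  {nothing} {inj₁ x} (x≢φl , _) x≡φl         = contradiction x≡φl x≢φl
    matched-injective {just u}  {just v}  {inj₁ x} (_ , eq)   (_ , eq′)    = cong just (old-left-injective eq eq′)
    matched-injective {just u}  {just v}  {inj₂ h} eq         eq′          = cong just (injective (trans eq (sym eq′)))

    -- The balance of the step, written without subtraction and proved by a single matching: the
    -- redex root with itself, kept nodes with their origins, fresh nodes with the nodes they copy.
    potential-exchange : pj sep prec ℓ G.labeledGraph (φ l) + sumOver (counted? H) (pj sep prec ℓ H.labeledGraph)
      ≤ sumOver (counted? G) (pj sep prec ℓ G.labeledGraph) + sumOver fresh? weight
    potential-exchange = subst₂ _≤_
      (cong (λ xs → pjG (φ l) + sum xs) (sym (map-∘ (elements (counted? H)))))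
      (trans (cong sum (map-++ target (map inj₁ Gs) (map inj₂ Ks)))
        (trans (sum-++ (map target (map inj₁ Gs)) (map target (map inj₂ Ks)))
          (cong₂ _+_ (cong sum (sym (map-∘ Gs))) (cong sum (sym (map-∘ Ks))))))
      (sum-matching Matched source target matched-injective (map inj₁ Gs ++ map inj₂ Ks) unique match)
      where
      pjG : G.Node → ℕ
      pjG = pj sep prec ℓ G.labeledGraph

      Gs : List G.Node
      Gs = elements (counted? G)

      Ks : List Node
      Ks = elements fresh?

      source : Maybe H.Node → ℕ
      source = maybe (pj sep prec ℓ H.labeledGraph) (pjG (φ l))

      target : G.Node ⊎ Node → ℕ
      target (inj₁ x) = pjG x
      target (inj₂ h) = weight h

      unique : Unique (nothing ∷ map just (elements (counted? H)))
      unique = All.map⁺ (All.tabulate λ _ ()) ∷ Unique.map⁺ just-injective (elements-unique (counted? H))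

      ∈-kept : ∀ {x} → ¬ IsConstructorGraph G.labeledGraph x → inj₁ x ∈ᴸ (map inj₁ Gs ++ map inj₂ Ks)
      ∈-kept ¬c = ∈-++⁺ˡ (∈-map⁺ inj₁ (∈-elements⁺ (counted? G) (counted-G ¬c)))

      match-counted : ∀ {v} → Counted H v → Origin (θ v) →
        ∃ λ y → y ∈ᴸ (map inj₁ Gs ++ map inj₂ Ks) × Matched (just v) y × source (just v) ≤ target y
      -- If the origin rooted a constructor graph, so would the kept node; thus the origin is
      -- counted in G.
      match-counted (_ , ¬c) (kept {x} x≢φl eq) =
        inj₁ x , ∈-kept (¬c ∘ constructor-old eq) , (x≢φl , eq) , pj-old eq
      match-counted _ (fresh {h} ¬p q h⊏l eq) =
        inj₂ h , ∈-++⁺ʳ (map inj₁ Gs) (∈-map⁺ inj₂ (∈-elements⁺ fresh? (q , ¬p))) , eq , pj-new h⊏l eq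

      match : ∀ {a} → a ∈ᴸ nothing ∷ map just (elements (counted? H)) →
        ∃ λ y → y ∈ᴸ (map inj₁ Gs ++ map inj₂ Ks) × Matched a y × source a ≤ target y
      match (here refl) = inj₁ (φ l) , ∈-kept φl-not-constructor , refl , ℕ.≤-refl
      match (there a∈) with ∈-map⁻ just a∈
      ... | v , v∈ , refl = match-counted (∈-elements⁻ (counted? H) v∈) (origin v)

    π-decreases : sumOver (counted? H) (pj sep prec ℓ H.labeledGraph)
                < sumOver (counted? G) (pj sep prec ℓ G.labeledGraph)
    π-decreases = ℕ.+-cancelˡ-< (pj sep prec ℓ G.labeledGraph (φ l)) _ _ (begin-strict
      pj sep prec ℓ G.labeledGraph (φ l) + sumOver (counted? H) (pj sep prec ℓ H.labeledGraph)
        ≤⟨ potential-exchange ⟩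
      sumOver (counted? G) (pj sep prec ℓ G.labeledGraph) + sumOver fresh? weight
        <⟨ ℕ.+-monoʳ-< (sumOver (counted? G) (pj sep prec ℓ G.labeledGraph)) total-weight<pj ⟩
      sumOver (counted? G) (pj sep prec ℓ G.labeledGraph) + pj sep prec ℓ G.labeledGraph (φ l)
        ≡⟨ ℕ.+-comm (sumOver (counted? G) (pj sep prec ℓ G.labeledGraph)) _ ⟩
      pj sep prec ℓ G.labeledGraph (φ l) + sumOver (counted? G) (pj sep prec ℓ G.labeledGraph) ∎)
      where open ℕ.≤-Reasoning

-- Rewrite sequences and the size of right-hand sides

module _ {F : Signature} (sep : Separation F) (prec : Precedence F) (𝒢 : GRS F)
         (constructorGRS : IsConstructorGRS 𝒢) (terminating : IsPrecedenceTerminating 𝒢 sep prec) where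

  step-invariant : ∀ {N G H} → Invariant sep N (TermGraph.labeledGraph G) → Step 𝒢 G H →
    Invariant sep N (TermGraph.labeledGraph H)
  step-invariant {G = G} {H} inv s = RewriteStep.preserved sep prec ρ (GRS.isRule 𝒢 rule)
    (constructorGRS ρ rule) (terminating ρ rule) G H φ isHom result inv
    where open Step s

  steps-invariant : ∀ {N G H} → Invariant sep N (TermGraph.labeledGraph G) → Steps 𝒢 G H →
    Invariant sep N (TermGraph.labeledGraph H)
  steps-invariant inv ε        = inv
  steps-invariant inv (s ◅ ss) = steps-invariant (step-invariant inv s) ss

  module _ {d : ℕ}
           (fin-size : ∀ ρ → 𝒢fin 𝒢 ρ → size↾ (Triple.K ρ) (Triple.r ρ) ≤ d)
           (inf-conditions : ∀ ρ → 𝒢inf 𝒢 ρ → InfRuleConditions sep d ρ) where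

    -- Whether a symbol is finitely defined is undecidable, but the bound to be proved is decidable.
    size-r-≤ : ∀ {N G H} → Invariant sep N (TermGraph.labeledGraph G) → (s : Step 𝒢 G H) →
      size↾ (Triple.K (Step.ρ s)) (Triple.r (Step.ρ s)) ≤ 1 + 2 * (N + d)
    size-r-≤ {N} {G} inv s = decidable-stable (size↾ K r ℕ.≤? 1 + 2 * (N + d)) λ ¬bound →
      let f₀ , lab-l , f₀∉C = proj₁ basic
          d≤bound = ℕ.≤-trans (ℕ.m≤n+m d N) (ℕ.≤-trans (ℕ.m≤n*m (N + d) 2) (ℕ.n≤1+n _))
          infinite = λ finite → ¬bound (ℕ.≤-trans (fin-size ρ (rule , f₀ , lab-l , f₀∉C , finite)) d≤bound)
          conditions = inf-conditions ρ (rule , f₀ , lab-l , f₀∉C , infinite)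
      in ¬bound (LeftCount.size-r-≤ sep prec ρ basic (terminating ρ rule) (TermGraph.labeledGraph G) φ isHom
           conditions (Invariant.nrm-bounded inv (φ l)))
      where
      open Step s
      open Triple ρ
      basic : Basic K l
      basic = constructorGRS ρ rule

mainTheorem5 :
    (F : Signature) (sep : Separation F) (prec : Precedence F) (𝒢 : GRS F) →
    IsConstructorGRS 𝒢 →
    IsPrecedenceTerminating 𝒢 sep prec →
    (d : ℕ) →
    (∀ f → Signature.ar F f ≤ d) →
    (∀ ρ → 𝒢fin 𝒢 ρ → size↾ (Triple.K ρ) (Triple.r ρ) ≤ d) →
    (∀ ρ → 𝒢inf 𝒢 ρ → InfRuleConditions sep d ρ) →
    (G₀ : TermGraph F) →
    Closed (TermGraph.labeledGraph G₀) (TermGraph.root G₀) →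
    Basic (TermGraph.labeledGraph G₀) (TermGraph.root G₀) →
    (G H : TermGraph F) → Steps 𝒢 G₀ G → Step 𝒢 G H →
    (ℓ : ℕ) → 0 < ℓ →
    2 * (card (nrmPart? sep (TermGraph.labeledGraph G₀) (TermGraph.root G₀)) + d) ≤ ℓ →
    Σ[ δG ∈ InDomain-π sep G ] Σ[ δH ∈ InDomain-π sep H ]
      π sep prec ℓ H δH < π sep prec ℓ G δG
mainTheorem5 F sep prec 𝒢 constructorGRS terminating d ar≤d fin-size inf-conditions
             G₀ closed basic G H G₀→*G G→H ℓ 0<ℓ bound≤ℓ =
  inDomain G invG , inDomain H invH ,
  RewriteStep.π-decreases sep prec ρ (GRS.isRule 𝒢 rule) (constructorGRS ρ rule) (terminating ρ rule)
    G H φ isHom result invG ar≤d 0<ℓ d≤ℓ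
    -- The bound 1 + 2 (N + d) on the right-hand side fits under the base 1 + ℓ of `pj`.
    (ℕ.≤-trans (size-r-≤ sep prec 𝒢 constructorGRS terminating fin-size inf-conditions invG G→H) (s≤s bound≤ℓ))
  where
  open Step G→H
  N : ℕ
  N = card (nrmPart? sep (TermGraph.labeledGraph G₀) (TermGraph.root G₀))

  invG : Invariant sep N (TermGraph.labeledGraph G)
  invG = steps-invariant sep prec 𝒢 constructorGRS terminating (basic-invariant sep G₀ closed basic) G₀→*G

  invH : Invariant sep N (TermGraph.labeledGraph H)
  invH = step-invariant sep prec 𝒢 constructorGRS terminating invG G→H

  d≤ℓ : d ≤ ℓ
  d≤ℓ = ℕ.≤-trans (ℕ.m≤n+m d N) (ℕ.≤-trans (ℕ.m≤n*m (N + d) 2) bound≤ℓ)
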